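{- Let $V$ be a finite set, $f:2^V\to\mathbb{R}_+$ a nonnegative submodular function, and $t_1,\ldots,t_k\in V$ distinct terminals. Let $\mathbf{x}=(x_{i,j})_{i\in[k],j\in V}$ be a feasible solution of the relaxation $$\min \sum_{i=1}^k \hat f(\mathbf{x}_i)\quad\text{s.t.}\quad \sum_{i=1}^k x_{i,j}=1\ \ \forall j\in V,\qquad x_{i,t_i}=1\ \ \forall i\in[k],\qquad x_{i,j}\ge 0\ \ \forall i,j,$$ where $\mathbf{x}_i=(x_{i,j})_{j\in V}$. Consider the following randomized rounding: choose $\theta\in(\tfrac12,1]$ uniformly at random, let $A_i(\theta)=\{j\in V: x_{i,j}>\theta\}$ for $i\in[k]$ and $U(\theta)=V\setminus\bigcup_{i=1}^k A_i(\theta)$, choose $i'\in[k]$ uniformly at random, and assign to terminal $i$ the set $A_i(\theta)$ if $i\neq i'$ and the set $A_{i'}(\theta)\cup U(\theta)$ if $i=i'$. Then this rounding produces a feasible solution (a partition $(S_1,\ldots,S_k)$ of $V$ with $t_i\in S_i$) whose expected value $\mathbb{E}[\sum_{i=1}^k f(S_i)]$ is at most $(2-\tfrac{2}{k})\sum_{i=1}^k \hat f(\mathbf{x}_i)$.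
   Context: For $\mathbf{y}\in[0,1]^V$, the Lovász extension is $\hat f(\mathbf{y})=\mathbb{E}_{\theta}[f(\{j\in V: y_j>\theta\})]$ where $\theta$ is uniform in $[0,1]$.
   Formalization: It is assumed that k ≥ 2 (for k = 1 the bound would be 0 while the rounding costs f(V)), and t_i ∈ S_i is claimed for θ in (1/2,1) only, i.e. with probability one, since at θ = 1 all sets A_i(θ) are empty. -}

module Defs where

open import Algebra.Bundles using (CommutativeRing)
open import Data.Bool.Base using (if_then_else_)
open import Data.Fin.Base using (Fin)
import Data.Fin.Properties as Fin
open import Data.Fin.Subset using (Subset; _∈_; _∪_; _∩_; ∁; ⋃; Empty)
open import Data.List.Base using (List; []; _∷_; concat; tabulate)
open import Data.List.Properties using (tabulate-cong)
open import Data.List.Relation.Unary.All using (All)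
import Data.List.Relation.Unary.All.Properties as All
open import Data.Nat.Base using (ℕ)
open import Data.Product.Base using (∃; _×_; _,_)
open import Data.Sum.Base using (_⊎_; inj₁; inj₂)
import Data.Vec.Base as Vec
import Data.Vec.Properties as Vec
open import Level using (suc; _⊔_)
open import Relation.Binary.Core using (Rel)
open import Relation.Binary.Structures using (IsStrictTotalOrder)
open import Relation.Binary.PropositionalEquality as ≡ using (_≡_; _≢_; cong; cong₂)
open import Relation.Nullary.Decidable using (does; dec-true; dec-false)
open import Relation.Nullary.Negation using (¬_)

-- Linearly ordered fields with decidable order; classically ℝ is one.
-- The inverse is total, with an unspecified value at 0#.
record OrderedField c ℓ₁ ℓ₂ : Set (suc (c ⊔ ℓ₁ ⊔ ℓ₂)) where
  infix  4 _<_ _≤_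
  infix  9 _⁻¹
  infixl 7 _÷_

  field
    commutativeRing : CommutativeRing c ℓ₁

  open CommutativeRing commutativeRing public

  field
    _⁻¹                : Carrier → Carrier
    ⁻¹-inverseʳ        : ∀ x → ¬ (x ≈ 0#) → x * x ⁻¹ ≈ 1#
    _<_                : Rel Carrier ℓ₂
    isStrictTotalOrder : IsStrictTotalOrder _≈_ _<_
    0<1                : 0# < 1#
    +-monoˡ-<          : ∀ z {x y} → x < y → x + z < y + z
    *-pos              : ∀ {x y} → 0# < x → 0# < y → 0# < x * y

  open IsStrictTotalOrder isStrictTotalOrder public
    using (_<?_; compare; asym; irrefl; <-resp-≈)
    renaming (trans to <-trans)

  _≤_ : Rel Carrier (ℓ₁ ⊔ ℓ₂)
  x ≤ y = x < y ⊎ x ≈ y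

  _÷_ : Carrier → Carrier → Carrier
  x ÷ y = x * y ⁻¹

  open import Algebra.Definitions.RawMonoid +-rawMonoid public
    using (sum) renaming (_×_ to _·_)

  fromℕ : ℕ → Carrier
  fromℕ m = m · 1#

  ½ : Carrier
  ½ = 1# ÷ fromℕ 2

module Expectation {c ℓ₁ ℓ₂} (K : OrderedField c ℓ₁ ℓ₂) where

  open OrderedField K

  SameSide : (p θ θ′ : Carrier) → Set ℓ₂
  SameSide p θ θ′ = (p < θ × p < θ′) ⊎ (θ < p × θ′ < p)

  -- A function with finitely many breakpoints that is constant on every open
  -- interval free of breakpoints; its values at breakpoints are unrestricted.
  record StepFunction : Set (c ⊔ ℓ₁ ⊔ ℓ₂) where
    field
      fun      : Carrier → Carrier
      breaks   : List Carrier
      constant : ∀ {θ θ′} → All (λ p → SameSide p θ θ′) breaks → fun θ ≈ fun θ′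

  -- For a ≤ b, cuts [a,b] at each listed point in its interior and sums
  -- length × (value at the midpoint) over the resulting pieces.
  integrate : (g : Carrier → Carrier) → List Carrier → (a b : Carrier) → Carrier
  integrate g []       a b = (b - a) * g ((a + b) * ½)
  integrate g (p ∷ ps) a b =
    if does (a <? p)
    then (if does (p <? b)
          then integrate g ps a p + integrate g ps p b
          else integrate g ps a b)
    else integrate g ps a b

  -- Expectation of g(θ), for a < b and θ uniform in the interval from a to b
  -- (endpoints have probability zero).
  𝔼-uniform : (a b : Carrier) → StepFunction → Carrier
  𝔼-uniform a b g = integrate fun breaks a b ÷ (b - a)
    where open StepFunction g

  𝔼-uniformFin : ∀ k → (Fin k → Carrier) → Carrier
  𝔼-uniformFin k h = sum h ÷ fromℕ k

module MultiwayPartition {c ℓ₁ ℓ₂} (K : OrderedField c ℓ₁ ℓ₂) where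

  open OrderedField K
  open Expectation K
  open import Algebra.Properties.Monoid.Sum +-monoid using (sum-cong-≗)

  Nonnegative : ∀ {n} → (Subset n → Carrier) → Set (ℓ₁ ⊔ ℓ₂)
  Nonnegative f = ∀ A → 0# ≤ f A

  Submodular : ∀ {n} → (Subset n → Carrier) → Set (ℓ₁ ⊔ ℓ₂)
  Submodular f = ∀ A B → f (A ∪ B) + f (A ∩ B) ≤ f A + f B

  -- {j : y j > θ}
  above : ∀ {n} → (Fin n → Carrier) → Carrier → Subset n
  above y θ = Vec.tabulate (λ j → does (θ <? y j))

  above-cong : ∀ {n} (y : Fin n → Carrier) {θ θ′} →
               (∀ j → SameSide (y j) θ θ′) → above y θ ≡ above y θ′
  above-cong y {θ} {θ′} same = Vec.tabulate-cong eq
    where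
    eq : ∀ j → does (θ <? y j) ≡ does (θ′ <? y j)
    eq j with same j
    ... | inj₁ (p , q) = ≡.trans (dec-false (θ <? y j) (asym p))
                                 (≡.sym (dec-false (θ′ <? y j) (asym q)))
    ... | inj₂ (p , q) = ≡.trans (dec-true (θ <? y j) p)
                                 (≡.sym (dec-true (θ′ <? y j) q))

  lovászStep : ∀ {n} → (Subset n → Carrier) → (Fin n → Carrier) → StepFunction
  lovászStep f y = record
    { fun      = λ θ → f (above y θ)
    ; breaks   = tabulate y
    ; constant = λ same → reflexive (cong f (above-cong y (All.tabulate⁻ same)))
    }

  lovász : ∀ {n} → (Subset n → Carrier) → (Fin n → Carrier) → Carrier
  lovász f y = 𝔼-uniform 0# 1# (lovászStep f y)

  record Feasible {n k} (t : Fin k → Fin n) (x : Fin k → Fin n → Carrier)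
                  : Set (ℓ₁ ⊔ ℓ₂) where
    field
      assigned : ∀ j → sum (λ i → x i j) ≈ 1#
      terminal : ∀ i → x i (t i) ≈ 1#
      nonneg   : ∀ i j → 0# ≤ x i j

  relaxationValue : ∀ {n k} → (Subset n → Carrier) → (Fin k → Fin n → Carrier) → Carrier
  relaxationValue f x = sum (λ i → lovász f (x i))

  record IsPartition {n k} (S : Fin k → Subset n) : Set where
    field
      disjoint : ∀ {i i′} → i ≢ i′ → Empty (S i ∩ S i′)
      covers   : ∀ j → ∃ λ i → j ∈ S i

  module Rounding {n k} (x : Fin k → Fin n → Carrier) where

    A : Carrier → Fin k → Subset n
    A θ i = above (x i) θ

    U : Carrier → Subset n
    U θ = ∁ (⋃ (tabulate (A θ)))

    rounded : Carrier → Fin k → (Fin k → Subset n)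
    rounded θ i′ i = if does (i Fin.≟ i′) then A θ i ∪ U θ else A θ i

    rounded-cong : ∀ {θ θ′} → (∀ i → A θ i ≡ A θ′ i) →
                   ∀ i′ i → rounded θ i′ i ≡ rounded θ′ i′ i
    rounded-cong eq i′ i =
      cong₂ (λ B W → if does (i Fin.≟ i′) then B ∪ W else B)
            (eq i) (cong (λ As → ∁ (⋃ As)) (tabulate-cong eq))

    -- The choices of θ and i′ are independent.
    costStep : (Subset n → Carrier) → StepFunction
    costStep f = record
      { fun      = λ θ → 𝔼-uniformFin k (λ i′ → sum (λ i → f (rounded θ i′ i)))
      ; breaks   = concat (tabulate (λ i → tabulate (x i)))
      ; constant = λ same →
          *-congʳ (reflexive (sum-cong-≗ (λ i′ → sum-cong-≗ (λ i →
            cong f (rounded-cong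
              (λ l → above-cong (x l)
                (All.tabulate⁻ (All.tabulate⁻ (All.concat⁻ same) l)))
              i′ i)))))
      }

    expectedCost : (Subset n → Carrier) → Carrier
    expectedCost f = 𝔼-uniform ½ 1# (costStep f)

{-# OPTIONS --safe #-}
-- Write F(θ) = Σᵢ f(Aᵢ(θ)) and δ = 1 − θ.  The greedy algorithm, run on V in the
-- order of increasing maxᵢ xᵢⱼ, gives a modular z with z(S) ≤ f(S) − f(∅) for all S
-- and equality on V and on every U(θ).  Put Z(θ) = Σᵢ z(Aᵢ(θ)).  For θ > ½ one has
-- U(θ) ∪ Aᵢ(δ) = Aᵢ(θ) ∪ U(θ), so submodularity gives
--   f(Aᵢ(θ) ∪ U(θ)) ≤ f(Aᵢ(δ)) + z(U(θ)) − z(U(θ) ∩ Aᵢ(δ)).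
-- Together with k − 2 copies of f(Aᵢ(δ)) ≥ f(∅) + z(Aᵢ(δ)), with f(∅), f(V) ≥ 0, and
-- since every element lies in U(θ), or else in exactly one Aᵢ(θ) and in exactly one
-- Aᵢ(δ), this bounds k times the expected cost at θ by
--   (k − 1) ((F − Z)(θ) + (F − Z)(1 − θ) + 2 z(V)).
-- Since ∫₀¹ Z = Σⱼ zⱼ Σᵢ xᵢⱼ = z(V), integrating over θ ∈ (½, 1) leaves (k − 1) ∫₀¹ F.
module Submission where

-- The geometric fact behind every case split: a column of `x` is nonnegative and sums to 1, so it
-- cannot exceed θ in one coordinate and θ′ in another once θ + θ′ ≥ 1. With θ′ = θ > ½ this makes
-- the Aᵢ(θ) disjoint; with θ′ = 1 - θ it explains why θ is paired with its reflection. Uncrossing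
-- all Aᵢ(1 - θ) with U(θ) leaves k copies of f(U(θ)) on the upper side. The sets U(θ) form a chain
-- as θ varies, so one modular z can be tight on all of them, and f(U(θ)) becomes a linear quantity
-- that can be counted element by element. The price is the correction 2 z(V) - Z(θ) - Z(1 - θ),
-- which may have either sign at a given θ and only averages out over (½, 1). The constant is the
-- density 2 of θ times (k - 1)/k. For k = 1 it is 0 while the cost is f(V), whence k ≥ 2. Over an
-- ordered field an integral is a finite sum attached to a list of cuts, and the Lovász extensions,
-- the cost and the reflected functions carry different lists. They can be compared only after
-- showing that the choice of cuts is immaterial.

open import Defs
open import Algebra.Bundles using (CommutativeMonoid; CommutativeRing)
open import Algebra.Solver.Ring.AlmostCommutativeRing using (_-Raw-AlmostCommutative⟶_; fromCommutativeRing)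
open import Data.Bool.Base using (Bool; true; false; if_then_else_)
open import Data.Fin.Base using (Fin; zero; suc)
import Data.Fin.Properties as Fin
open import Data.Fin.Subset using (Subset; _∈_; _∉_; _⊆_; _∪_; _∩_; ⁅_⁆; ⊤; ⊥; ⋃; Empty)
open import Data.Fin.Subset.Properties
open import Data.Integer.Base as ℤ using (ℤ; +_; -[1+_])
import Data.Integer.Properties as ℤ
open import Data.List.Base using (List; []; _∷_; _++_; allFin; concat; map; tabulate)
import Data.List.Membership.Propositional as List
open import Data.List.Membership.Propositional.Properties using (∈-allFin)
open import Data.List.Properties using (++-identityʳ)
open import Data.List.Relation.Binary.Permutation.Propositional using (↭-sym)
open import Data.List.Relation.Binary.Permutation.Propositional.Properties using (∈-resp-↭)
open import Data.List.Relation.Binary.Pointwise.Base using (Pointwise; []; _∷_)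
open import Data.List.Relation.Unary.All as All using (All; []; _∷_)
import Data.List.Relation.Unary.All.Properties as All
open import Data.List.Relation.Unary.AllPairs as AllPairs using (AllPairs; []; _∷_)
open import Data.List.Relation.Unary.Any using (here; there)
open import Data.List.Relation.Unary.Linked.Properties using (Linked⇒AllPairs)
import Data.Maybe.Base as Maybe
open import Data.Nat.Base as ℕ using (ℕ; zero; suc)
import Data.Nat.Properties as ℕ
open import Data.Product.Base using (∃; _×_; _,_; proj₁; proj₂)
open import Data.Sum.Base using (_⊎_; inj₁; inj₂; [_,_]′)
open import Data.Vec.Base using (lookup)
open import Data.Vec.Properties using (lookup⇒[]=; []=⇒lookup; lookup∘tabulate) renaming (tabulate-cong to tabulateᵥ-cong)
open import Function.Base using (_∘_; case_of_)
open import Function.Bundles using (mk⇔)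
open import Function.Definitions using (Injective)
open import Level using (_⊔_)
open import Relation.Binary.Bundles using (DecTotalOrder)
import Relation.Binary.Construct.On as On
open import Relation.Binary.Definitions using (tri<; tri≈; tri>)
open import Relation.Binary.PropositionalEquality as ≡ using (_≡_; _≢_)
import Relation.Binary.Reasoning.Base.Triple as Triple
open import Relation.Nullary.Decidable using (yes; no; does; dec-true; dec-false; does-⇔; _×-dec_)
open import Relation.Nullary.Decidable.Core using (dec⇒maybe)
open import Relation.Nullary.Negation using (¬_; contradiction)

-- Ring normalisation with integer coefficients.

-- Integer coefficients let the normaliser recognise cancellations such as x − x,
-- which coefficients from an abstract ring would not.
module IntegerSolver {c ℓ} (R : CommutativeRing c ℓ) where
  open CommutativeRing R
  open import Algebra.Properties.Semiring.Mult.TCOptimised semiring using (1+×; ×-homo-+; ×1-homo-*) renaming (_×_ to _·′_)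
  open import Algebra.Properties.Ring ring
  open import Algebra.Properties.AbelianGroup +-abelianGroup using (⁻¹-∙-comm)
  open import Algebra.Properties.CommutativeSemigroup (CommutativeMonoid.commutativeSemigroup +-commutativeMonoid) using (interchange)
  open import Relation.Binary.Reasoning.Setoid setoid

  -- This form of multiples reduces `1 ·′ x` to `x`, so `con (+ 1)` evaluates to `1#` itself and
  -- solved equations match goals that mention `1#`.
  ⟦_⟧ℤ : ℤ → Carrier
  ⟦ + n ⟧ℤ      = n ·′ 1#
  ⟦ -[1+ n ] ⟧ℤ = - (suc n ·′ 1#)

  ⟦⟧-neg : ∀ i → ⟦ ℤ.- i ⟧ℤ ≈ - ⟦ i ⟧ℤ
  ⟦⟧-neg (+ zero)    = sym -0#≈0#
  ⟦⟧-neg (+ (suc n)) = refl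
  ⟦⟧-neg -[1+ n ]    = sym (-‿involutive _)

  ⟦⟧-⊖ : ∀ m n → ⟦ m ℤ.⊖ n ⟧ℤ ≈ m ·′ 1# - n ·′ 1#
  ⟦⟧-⊖ m       zero    = sym (trans (+-congˡ -0#≈0#) (+-identityʳ _))
  ⟦⟧-⊖ zero    (suc n) = sym (+-identityˡ _)
  ⟦⟧-⊖ (suc m) (suc n) = begin
    ⟦ suc m ℤ.⊖ suc n ⟧ℤ                    ≡⟨ ≡.cong ⟦_⟧ℤ (ℤ.[1+m]⊖[1+n]≡m⊖n m n) ⟩
    ⟦ m ℤ.⊖ n ⟧ℤ                            ≈⟨ ⟦⟧-⊖ m n ⟩
    m ·′ 1# - n ·′ 1#                       ≈⟨ +-identityˡ _ ⟨
    0# + (m ·′ 1# - n ·′ 1#)                ≈⟨ +-congʳ (-‿inverseʳ 1#) ⟨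
    (1# - 1#) + (m ·′ 1# - n ·′ 1#)         ≈⟨ interchange 1# (- 1#) _ _ ⟩
    (1# + m ·′ 1#) + (- 1# - n ·′ 1#)       ≈⟨ +-congˡ (⁻¹-∙-comm _ _) ⟩
    (1# + m ·′ 1#) - (1# + n ·′ 1#)         ≈⟨ +-cong (1+× m 1#) (-‿cong (1+× n 1#)) ⟨
    suc m ·′ 1# - suc n ·′ 1#               ∎

  ⟦⟧-+ : ∀ i j → ⟦ i ℤ.+ j ⟧ℤ ≈ ⟦ i ⟧ℤ + ⟦ j ⟧ℤ
  ⟦⟧-+ (+ m)    (+ n)    = ×-homo-+ 1# m n
  ⟦⟧-+ (+ m)    -[1+ n ] = ⟦⟧-⊖ m (suc n)
  ⟦⟧-+ -[1+ m ] (+ n)    = trans (⟦⟧-⊖ n (suc m)) (+-comm _ _)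
  ⟦⟧-+ -[1+ m ] -[1+ n ] = begin
    - (suc (suc (m ℕ.+ n)) ·′ 1#)      ≡⟨ ≡.cong (λ l → - (suc l ·′ 1#)) (ℕ.+-suc m n) ⟨
    - ((suc m ℕ.+ suc n) ·′ 1#)        ≈⟨ -‿cong (×-homo-+ 1# (suc m) (suc n)) ⟩
    - (suc m ·′ 1# + suc n ·′ 1#)      ≈⟨ ⁻¹-∙-comm _ _ ⟨
    - (suc m ·′ 1#) - suc n ·′ 1#      ∎

  ⟦⟧-*-pos : ∀ m j → ⟦ + m ℤ.* j ⟧ℤ ≈ ⟦ + m ⟧ℤ * ⟦ j ⟧ℤ
  ⟦⟧-*-pos m (+ n) = trans (reflexive (≡.cong ⟦_⟧ℤ (≡.sym (ℤ.pos-* m n)))) (×1-homo-* m n)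
  ⟦⟧-*-pos m -[1+ n ] = begin
    ⟦ + m ℤ.* -[1+ n ] ⟧ℤ            ≡⟨ ≡.cong ⟦_⟧ℤ (ℤ.neg-distribʳ-* (+ m) (+ suc n)) ⟨
    ⟦ ℤ.- (+ m ℤ.* + suc n) ⟧ℤ       ≈⟨ ⟦⟧-neg (+ m ℤ.* + suc n) ⟩
    - ⟦ + m ℤ.* + suc n ⟧ℤ           ≈⟨ -‿cong (⟦⟧-*-pos m (+ suc n)) ⟩
    - (m ·′ 1# * suc n ·′ 1#)        ≈⟨ -‿distribʳ-* _ _ ⟩
    m ·′ 1# * - (suc n ·′ 1#)        ∎

  ⟦⟧-* : ∀ i j → ⟦ i ℤ.* j ⟧ℤ ≈ ⟦ i ⟧ℤ * ⟦ j ⟧ℤ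
  ⟦⟧-* (+ m)    j = ⟦⟧-*-pos m j
  ⟦⟧-* -[1+ m ] j = begin
    ⟦ -[1+ m ] ℤ.* j ⟧ℤ              ≡⟨ ≡.cong ⟦_⟧ℤ (ℤ.neg-distribˡ-* (+ suc m) j) ⟨
    ⟦ ℤ.- (+ suc m ℤ.* j) ⟧ℤ         ≈⟨ ⟦⟧-neg (+ suc m ℤ.* j) ⟩
    - ⟦ + suc m ℤ.* j ⟧ℤ             ≈⟨ -‿cong (⟦⟧-*-pos (suc m) j) ⟩
    - (suc m ·′ 1# * ⟦ j ⟧ℤ)         ≈⟨ -‿distribˡ-* _ _ ⟩
    - (suc m ·′ 1#) * ⟦ j ⟧ℤ         ∎

  ℤ⟶R : ℤ.+-*-rawRing -Raw-AlmostCommutative⟶ fromCommutativeRing R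
  ℤ⟶R = record
    { ⟦_⟧    = ⟦_⟧ℤ
    ; +-homo = ⟦⟧-+
    ; *-homo = ⟦⟧-*
    ; -‿homo = ⟦⟧-neg
    ; 0-homo = refl
    ; 1-homo = refl
    }

  open import Algebra.Solver.Ring ℤ.+-*-rawRing (fromCommutativeRing R) ℤ⟶R
    (λ i j → Maybe.map (reflexive ∘ ≡.cong ⟦_⟧ℤ) (dec⇒maybe (i ℤ.≟ j))) public
    using (solve; con; _:+_; _:*_; _:-_; :-_; _:=_)

-- Ordered field arithmetic and finite sums.

module OrderedFieldProperties {c ℓ₁ ℓ₂} (K : OrderedField c ℓ₁ ℓ₂) where
  open OrderedField K hiding (zero)
  open IntegerSolver commutativeRing
  open import Relation.Binary.Construct.StrictToNonStrict _≈_ _<_ as NonStrict using (isDecTotalOrder)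
  open import Algebra.Properties.CommutativeMonoid.Sum +-commutativeMonoid using (sum-cong-≋)

  ≤-decTotalOrder : DecTotalOrder c ℓ₁ (ℓ₁ ⊔ ℓ₂)
  ≤-decTotalOrder = record { isDecTotalOrder = isDecTotalOrder isStrictTotalOrder }

  open DecTotalOrder ≤-decTotalOrder public
    using () renaming (refl to ≤-refl; trans to ≤-trans; isPreorder to ≤-isPreorder)

  <-respʳ-≈ : ∀ {x y z} → y ≈ z → x < y → x < z
  <-respʳ-≈ = proj₁ <-resp-≈

  <-respˡ-≈ : ∀ {x y z} → y ≈ z → y < x → z < x
  <-respˡ-≈ = proj₂ <-resp-≈

  <-≤-trans : ∀ {x y z} → x < y → y ≤ z → x < z
  <-≤-trans = NonStrict.<-≤-trans <-trans <-respʳ-≈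

  ≤-<-trans : ∀ {x y z} → x ≤ y → y < z → x < z
  ≤-<-trans = NonStrict.≤-<-trans sym <-trans <-respˡ-≈

  module ≤-Reasoning = Triple ≤-isPreorder asym <-trans <-resp-≈ inj₁ <-≤-trans ≤-<-trans

  ≮⇒≥ : ∀ {x y} → ¬ (x < y) → y ≤ x
  ≮⇒≥ {x} {y} x≮y with compare x y
  ... | tri< x<y _ _ = contradiction x<y x≮y
  ... | tri≈ _ x≈y _ = inj₂ (sym x≈y)
  ... | tri> _ _ y<x = inj₁ y<x

  ≤⇒≯ : ∀ {x y} → x ≤ y → ¬ (y < x)
  ≤⇒≯ x≤y y<x = irrefl refl (≤-<-trans x≤y y<x)

  +-monoʳ-< : ∀ z {x y} → x < y → z + x < z + y
  +-monoʳ-< z x<y = <-respˡ-≈ (+-comm _ z) (<-respʳ-≈ (+-comm _ z) (+-monoˡ-< z x<y))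

  +-mono-< : ∀ {x y u v} → x < y → u < v → x + u < y + v
  +-mono-< {y = y} {u = u} x<y u<v = <-trans (+-monoˡ-< u x<y) (+-monoʳ-< y u<v)

  +-monoˡ-≤ : ∀ z {x y} → x ≤ y → x + z ≤ y + z
  +-monoˡ-≤ z (inj₁ x<y) = inj₁ (+-monoˡ-< z x<y)
  +-monoˡ-≤ z (inj₂ x≈y) = inj₂ (+-congʳ x≈y)

  +-monoʳ-≤ : ∀ z {x y} → x ≤ y → z + x ≤ z + y
  +-monoʳ-≤ z (inj₁ x<y) = inj₁ (+-monoʳ-< z x<y)
  +-monoʳ-≤ z (inj₂ x≈y) = inj₂ (+-congˡ x≈y)

  +-mono-≤ : ∀ {x y u v} → x ≤ y → u ≤ v → x + u ≤ y + v
  +-mono-≤ {y = y} {u = u} x≤y u≤v = ≤-trans (+-monoˡ-≤ u x≤y) (+-monoʳ-≤ y u≤v)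

  x<y⇒0<y-x : ∀ {x y} → x < y → 0# < y - x
  x<y⇒0<y-x {x} x<y = <-respˡ-≈ (-‿inverseʳ x) (+-monoˡ-< (- x) x<y)

  x≤y⇒0≤y-x : ∀ {x y} → x ≤ y → 0# ≤ y - x
  x≤y⇒0≤y-x {x} x≤y = ≤-trans (inj₂ (sym (-‿inverseʳ x))) (+-monoˡ-≤ (- x) x≤y)

  0≤y-x⇒x≤y : ∀ {x y} → 0# ≤ y - x → x ≤ y
  0≤y-x⇒x≤y {x} {y} 0≤ = begin
    x           ≈⟨ +-identityˡ x ⟨
    0# + x      ≤⟨ +-monoˡ-≤ x 0≤ ⟩
    y - x + x   ≈⟨ solve 2 (λ x y → y :- x :+ x := y) refl x y ⟩
    y           ∎
    where open ≤-Reasoning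

  0<y-x⇒x<y : ∀ {x y} → 0# < y - x → x < y
  0<y-x⇒x<y {x} {y} 0< = begin-strict
    x           ≈⟨ +-identityˡ x ⟨
    0# + x      <⟨ +-monoˡ-< x 0< ⟩
    y - x + x   ≈⟨ solve 2 (λ x y → y :- x :+ x := y) refl x y ⟩
    y           ∎
    where open ≤-Reasoning

  +-nonneg : ∀ {x y} → 0# ≤ x → 0# ≤ y → 0# ≤ x + y
  +-nonneg 0≤x 0≤y = ≤-trans (inj₂ (sym (+-identityˡ 0#))) (+-mono-≤ 0≤x 0≤y)

  *-nonneg : ∀ {x y} → 0# ≤ x → 0# ≤ y → 0# ≤ x * y
  *-nonneg (inj₁ 0<x) (inj₁ 0<y) = inj₁ (*-pos 0<x 0<y)
  *-nonneg {x} (inj₁ _) (inj₂ 0≈y) = inj₂ (trans (sym (zeroʳ x)) (*-congˡ 0≈y))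
  *-nonneg {y = y} (inj₂ 0≈x) _    = inj₂ (trans (sym (zeroˡ y)) (*-congʳ 0≈x))

  *-monoˡ-≤ : ∀ {x y z} → 0# ≤ z → x ≤ y → z * x ≤ z * y
  *-monoˡ-≤ {x} {y} {z} 0≤z x≤y = 0≤y-x⇒x≤y (≤-trans (*-nonneg 0≤z (x≤y⇒0≤y-x x≤y))
    (inj₂ (solve 3 (λ x y z → z :* (y :- x) := z :* y :- z :* x) refl x y z)))

  *-monoˡ-< : ∀ {x y z} → 0# < z → x < y → z * x < z * y
  *-monoˡ-< {x} {y} {z} 0<z x<y = 0<y-x⇒x<y (<-respʳ-≈
    (solve 3 (λ x y z → z :* (y :- x) := z :* y :- z :* x) refl x y z) (*-pos 0<z (x<y⇒0<y-x x<y)))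

  1-reverses-< : ∀ {x y} → x < y → 1# - y < 1# - x
  1-reverses-< {x} {y} x<y = 0<y-x⇒x<y (<-respʳ-≈
    (solve 2 (λ x y → y :- x := con (+ 1) :- x :- (con (+ 1) :- y)) refl x y) (x<y⇒0<y-x x<y))

  1-[1-x]≈x : ∀ x → 1# - (1# - x) ≈ x
  1-[1-x]≈x = solve 1 (λ x → con (+ 1) :- (con (+ 1) :- x) := x) refl

  fromℕ-nonneg : ∀ m → 0# ≤ fromℕ m
  fromℕ-nonneg zero    = ≤-refl
  fromℕ-nonneg (suc m) = +-nonneg (inj₁ 0<1) (fromℕ-nonneg m)

  fromℕ-pos : ∀ m → 0# < fromℕ (suc m)
  fromℕ-pos m = <-≤-trans 0<1 (≤-trans (inj₂ (sym (+-identityʳ 1#))) (+-monoʳ-≤ 1# (fromℕ-nonneg m)))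

  ⁻¹-inverse : ∀ {x} → 0# < x → x * x ⁻¹ ≈ 1#
  ⁻¹-inverse {x} 0<x = ⁻¹-inverseʳ x (λ x≈0 → irrefl (sym x≈0) 0<x)

  -- `_⁻¹` is not assumed to respect `_≈_`, so the inverses of interval lengths such as `1# - ½` are
  -- evaluated through this.
  ⁻¹-unique : ∀ {x y} → 0# < x → x * y ≈ 1# → x ⁻¹ ≈ y
  ⁻¹-unique {x} {y} 0<x xy≈1 = begin
    x ⁻¹               ≈⟨ *-identityʳ _ ⟨
    x ⁻¹ * 1#          ≈⟨ *-congˡ xy≈1 ⟨
    x ⁻¹ * (x * y)     ≈⟨ solve 3 (λ x y z → z :* (x :* y) := (x :* z) :* y) refl x y (x ⁻¹) ⟩
    (x * x ⁻¹) * y     ≈⟨ *-congʳ (⁻¹-inverse 0<x) ⟩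
    1# * y             ≈⟨ *-identityˡ y ⟩
    y                  ∎
    where open import Relation.Binary.Reasoning.Setoid setoid

  ⁻¹-pos : ∀ {x} → 0# < x → 0# < x ⁻¹
  ⁻¹-pos {x} 0<x with compare 0# (x ⁻¹)
  ... | tri< 0<x⁻¹ _ _ = 0<x⁻¹
  ... | tri≈ _ 0≈x⁻¹ _ = contradiction 0<1
    (irrefl (trans (sym (zeroʳ x)) (trans (*-congˡ 0≈x⁻¹) (⁻¹-inverse 0<x))))
  ... | tri> _ _ x⁻¹<0 = contradiction 0<1 (asym (begin-strict
    1#             ≈⟨ ⁻¹-inverse 0<x ⟨
    x * x ⁻¹       <⟨ *-monoˡ-< 0<x x⁻¹<0 ⟩
    x * 0#         ≈⟨ zeroʳ x ⟩
    0#             ∎))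
    where open ≤-Reasoning

  ½+½≈1 : ½ + ½ ≈ 1#
  ½+½≈1 = trans
    -- `fromℕ 2` unfolds to `1# + (1# + 0#)`, which the right side has to spell out.
    (solve 1 (λ h → con (+ 1) :* h :+ con (+ 1) :* h := (con (+ 1) :+ (con (+ 1) :+ con (+ 0))) :* h) refl (fromℕ 2 ⁻¹))
    (⁻¹-inverse (fromℕ-pos 1))

  ½-pos : 0# < ½
  ½-pos = *-pos 0<1 (⁻¹-pos (fromℕ-pos 1))

  1-½≈½ : 1# - ½ ≈ ½
  1-½≈½ = trans (+-congʳ (sym ½+½≈1)) (solve 1 (λ h → h :+ h :- h := h) refl ½)

  ½<1 : ½ < 1#
  ½<1 = <-respˡ-≈ (+-identityʳ ½) (<-respʳ-≈ ½+½≈1 (+-monoʳ-< ½ ½-pos))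

  a<mid : ∀ {a b} → a < b → a < (a + b) * ½
  a<mid {a} {b} a<b = begin-strict
    a                ≈⟨ *-identityˡ a ⟨
    1# * a           ≈⟨ *-congʳ ½+½≈1 ⟨
    (½ + ½) * a      ≈⟨ solve 2 (λ h a → (h :+ h) :* a := h :* (a :+ a)) refl ½ a ⟩
    ½ * (a + a)      <⟨ *-monoˡ-< ½-pos (+-monoʳ-< a a<b) ⟩
    ½ * (a + b)      ≈⟨ *-comm _ _ ⟩
    (a + b) * ½      ∎
    where open ≤-Reasoning

  mid<b : ∀ {a b} → a < b → (a + b) * ½ < b
  mid<b {a} {b} a<b = begin-strict
    (a + b) * ½      ≈⟨ *-comm _ _ ⟩
    ½ * (a + b)      <⟨ *-monoˡ-< ½-pos (+-monoˡ-< b a<b) ⟩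
    ½ * (b + b)      ≈⟨ solve 2 (λ h a → (h :+ h) :* a := h :* (a :+ a)) refl ½ b ⟨
    (½ + ½) * b      ≈⟨ *-congʳ ½+½≈1 ⟩
    1# * b           ≈⟨ *-identityˡ b ⟩
    b                ∎
    where open ≤-Reasoning

  sum-mono-≤ : ∀ {n} {s t : Fin n → Carrier} → (∀ i → s i ≤ t i) → sum s ≤ sum t
  sum-mono-≤ {zero}  s≤t = ≤-refl
  sum-mono-≤ {suc n} s≤t = +-mono-≤ (s≤t zero) (sum-mono-≤ (s≤t ∘ suc))

  sum-nonneg : ∀ {n} {s : Fin n → Carrier} → (∀ i → 0# ≤ s i) → 0# ≤ sum s
  sum-nonneg {zero}  0≤s = ≤-refl
  sum-nonneg {suc n} 0≤s = +-nonneg (0≤s zero) (sum-nonneg (0≤s ∘ suc))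

  *-distribʳ-sum : ∀ {n} z (s : Fin n → Carrier) → sum (λ i → s i * z) ≈ sum s * z
  *-distribʳ-sum {zero}  z s = sym (zeroˡ z)
  *-distribʳ-sum {suc n} z s = trans (+-congˡ (*-distribʳ-sum z (s ∘ suc))) (sym (distribʳ z _ _))

  sum-const : ∀ n z → sum {n} (λ _ → z) ≈ fromℕ n * z
  sum-const zero    z = sym (zeroˡ z)
  sum-const (suc n) z = trans (+-cong (sym (*-identityˡ z)) (sum-const n z)) (sym (distribʳ z _ _))

  term≤sum : ∀ {n} {s : Fin n → Carrier} → (∀ i → 0# ≤ s i) → ∀ i → s i ≤ sum s
  term≤sum 0≤s zero    = ≤-trans (inj₂ (sym (+-identityʳ _))) (+-monoʳ-≤ _ (sum-nonneg (0≤s ∘ suc)))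
  term≤sum 0≤s (suc i) = ≤-trans (inj₂ (sym (+-identityˡ _))) (+-mono-≤ (0≤s zero) (term≤sum (0≤s ∘ suc) i))

  pair≤sum : ∀ {n} {s : Fin n → Carrier} → (∀ i → 0# ≤ s i) → ∀ i j → i ≢ j → s i + s j ≤ sum s
  pair≤sum 0≤s zero    zero    i≢j = contradiction ≡.refl i≢j
  pair≤sum 0≤s zero    (suc j) _   = +-monoʳ-≤ _ (term≤sum (0≤s ∘ suc) j)
  pair≤sum 0≤s (suc i) zero    _   = ≤-trans (inj₂ (+-comm _ _)) (+-monoʳ-≤ _ (term≤sum (0≤s ∘ suc) i))
  pair≤sum 0≤s (suc i) (suc j) i≢j = ≤-trans (inj₂ (sym (+-identityˡ _)))
    (+-mono-≤ (0≤s zero) (pair≤sum (0≤s ∘ suc) i j (i≢j ∘ ≡.cong suc)))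

  sum-single : ∀ {n} {s : Fin n → Carrier} i → (∀ i′ → i′ ≢ i → s i′ ≈ 0#) → sum s ≈ s i
  sum-single {suc n} {s} zero rest = trans (+-congˡ (trans (sum-cong-≋ (λ i → rest (suc i) λ ())) (trans (sum-const n 0#) (zeroʳ _)))) (+-identityʳ _)
  sum-single {suc n} {s} (suc i) rest =
    trans (+-cong (rest zero λ ()) (sum-single i (λ i′ i′≢i → rest (suc i′) (i′≢i ∘ Fin.suc-injective)))) (+-identityˡ _)

  -- Changing the single term `i`, phrased without subtraction. It compares a rounded solution, in
  -- which only the part of `i′` is enlarged, with the plain level sets.
  sum-update : ∀ {n} {s q : Fin n → Carrier} i → (∀ i′ → i′ ≢ i → s i′ ≈ q i′) → sum s + q i ≈ sum q + s i
  sum-update {suc n} {s} {q} zero rest = trans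
    (+-congʳ (+-congˡ (sum-cong-≋ (λ i → rest (suc i) λ ()))))
    (solve 3 (λ x y z → (x :+ y) :+ z := (z :+ y) :+ x) refl (s zero) (sum (q ∘ suc)) (q zero))
  sum-update {suc n} {s} {q} (suc i) rest = begin
    s zero + sum (s ∘ suc) + q (suc i)     ≈⟨ +-assoc _ _ _ ⟩
    s zero + (sum (s ∘ suc) + q (suc i))   ≈⟨ +-cong (rest zero λ ()) (sum-update i (λ i′ i′≢i → rest (suc i′) (i′≢i ∘ Fin.suc-injective))) ⟩
    q zero + (sum (q ∘ suc) + s (suc i))   ≈⟨ +-assoc _ _ _ ⟨
    q zero + sum (q ∘ suc) + s (suc i)     ∎
    where open import Relation.Binary.Reasoning.Setoid setoid

  1≤θ+θ : ∀ {θ} → ½ < θ → 1# ≤ θ + θ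
  1≤θ+θ ½<θ = ≤-trans (inj₂ (sym ½+½≈1)) (inj₁ (+-mono-< ½<θ ½<θ))

-- Integrals of step functions.

module Integration {c ℓ₁ ℓ₂} (K : OrderedField c ℓ₁ ℓ₂) where
  open OrderedField K hiding (zero)
  open Expectation K
  open IntegerSolver commutativeRing
  open OrderedFieldProperties K

  PiecewiseConstant : (Carrier → Carrier) → List Carrier → (a b : Carrier) → Set (c ⊔ ℓ₁ ⊔ ℓ₂)
  PiecewiseConstant g ps a b = ∀ {θ θ′} → a < θ × θ < b → a < θ′ × θ′ < b →
    All (λ p → SameSide p θ θ′) ps → g θ ≈ g θ′

  integrate-cut : ∀ g {p} ps {a b} → a < p → p < b →
                  integrate g (p ∷ ps) a b ≡ integrate g ps a p + integrate g ps p b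
  integrate-cut g {p} ps {a} {b} a<p p<b
    rewrite dec-true (a <? p) a<p | dec-true (p <? b) p<b = ≡.refl

  integrate-skip : ∀ g {p} ps {a b} → ¬ (a < p × p < b) →
                   integrate g (p ∷ ps) a b ≡ integrate g ps a b
  integrate-skip g {p} ps {a} {b} out with a <? p | p <? b
  ... | yes a<p | yes p<b = contradiction (a<p , p<b) out
  ... | yes _   | no  _   = ≡.refl
  ... | no  _   | _       = ≡.refl

  integrate-cong : ∀ {g h ps qs a a′ b b′} → (∀ {θ θ′} → θ ≈ θ′ → g θ ≈ h θ′) →
                   Pointwise _≈_ ps qs → a ≈ a′ → b ≈ b′ →
                   integrate g ps a b ≈ integrate h qs a′ b′
  integrate-cong g≈h [] a≈a′ b≈b′ =
    *-cong (+-cong b≈b′ (-‿cong a≈a′)) (g≈h (*-congʳ (+-cong a≈a′ b≈b′)))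
  integrate-cong {g} {h} {p ∷ ps} {q ∷ qs} {a} {a′} {b} {b′} g≈h (p≈q ∷ ps≈qs) a≈a′ b≈b′
    with (a <? p) ×-dec (p <? b)
  ... | yes (a<p , p<b) = begin
    integrate g (p ∷ ps) a b                        ≡⟨ integrate-cut g ps a<p p<b ⟩
    integrate g ps a p + integrate g ps p b         ≈⟨ +-cong (integrate-cong g≈h ps≈qs a≈a′ p≈q) (integrate-cong g≈h ps≈qs p≈q b≈b′) ⟩
    integrate h qs a′ q + integrate h qs q b′       ≡⟨ integrate-cut h qs (<-respˡ-≈ a≈a′ (<-respʳ-≈ p≈q a<p)) (<-respˡ-≈ p≈q (<-respʳ-≈ b≈b′ p<b)) ⟨
    integrate h (q ∷ qs) a′ b′                      ∎
    where open import Relation.Binary.Reasoning.Setoid setoid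
  ... | no out = begin
    integrate g (p ∷ ps) a b                        ≡⟨ integrate-skip g ps out ⟩
    integrate g ps a b                              ≈⟨ integrate-cong g≈h ps≈qs a≈a′ b≈b′ ⟩
    integrate h qs a′ b′                            ≡⟨ integrate-skip h qs (λ (l , r) → out (<-respˡ-≈ (sym a≈a′) (<-respʳ-≈ (sym p≈q) l) , <-respˡ-≈ (sym p≈q) (<-respʳ-≈ (sym b≈b′) r))) ⟨
    integrate h (q ∷ qs) a′ b′                      ∎
    where open import Relation.Binary.Reasoning.Setoid setoid

  pointwise-refl : ∀ ps → Pointwise _≈_ ps ps
  pointwise-refl []       = []
  pointwise-refl (p ∷ ps) = refl ∷ pointwise-refl ps

  integrate-ext : ∀ {g h} ps a b → (∀ θ → g θ ≈ h θ) → integrate g ps a b ≈ integrate h ps a b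
  integrate-ext []       a b g≈h = *-congˡ (g≈h _)
  integrate-ext (p ∷ ps) a b g≈h with a <? p | p <? b
  ... | yes _ | yes _ = +-cong (integrate-ext ps a p g≈h) (integrate-ext ps p b g≈h)
  ... | yes _ | no  _ = integrate-ext ps a b g≈h
  ... | no  _ | _     = integrate-ext ps a b g≈h

  -- Functions are sampled only at midpoints of pieces, which lie strictly between `a` and `b`;
  -- hence an inequality on the open interval suffices.
  integrate-mono : ∀ {g h} ps {a b} → a < b → (∀ {θ} → a < θ → θ < b → g θ ≤ h θ) →
                   integrate g ps a b ≤ integrate h ps a b
  integrate-mono [] a<b g≤h = *-monoˡ-≤ (inj₁ (x<y⇒0<y-x a<b)) (g≤h (a<mid a<b) (mid<b a<b))
  integrate-mono {g} {h} (p ∷ ps) {a} {b} a<b g≤h with a <? p | p <? b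
  ... | yes a<p | yes p<b = +-mono-≤
        (integrate-mono ps a<p (λ l r → g≤h l (<-trans r p<b)))
        (integrate-mono ps p<b (λ l r → g≤h (<-trans a<p l) r))
  ... | yes _   | no  _   = integrate-mono ps a<b g≤h
  ... | no  _   | _       = integrate-mono ps a<b g≤h

  integrate-+ : ∀ g h ps a b → integrate (λ θ → g θ + h θ) ps a b ≈ integrate g ps a b + integrate h ps a b
  integrate-+ g h []       a b = distribˡ _ _ _
  integrate-+ g h (p ∷ ps) a b with a <? p | p <? b
  ... | yes _ | yes _ = trans (+-cong (integrate-+ g h ps a p) (integrate-+ g h ps p b))
        (solve 4 (λ x y z w → (x :+ y) :+ (z :+ w) := (x :+ z) :+ (y :+ w)) refl _ _ _ _)
  ... | yes _ | no  _ = integrate-+ g h ps a b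
  ... | no  _ | _     = integrate-+ g h ps a b

  integrate-* : ∀ z g ps a b → integrate (λ θ → z * g θ) ps a b ≈ z * integrate g ps a b
  integrate-* z g []       a b = solve 3 (λ z l v → l :* (z :* v) := z :* (l :* v)) refl z _ _
  integrate-* z g (p ∷ ps) a b with a <? p | p <? b
  ... | yes _ | yes _ = trans (+-cong (integrate-* z g ps a p) (integrate-* z g ps p b)) (sym (distribˡ z _ _))
  ... | yes _ | no  _ = integrate-* z g ps a b
  ... | no  _ | _     = integrate-* z g ps a b

  integrate-const : ∀ z ps a b → integrate (λ _ → z) ps a b ≈ (b - a) * z
  integrate-const z []       a b = refl
  integrate-const z (p ∷ ps) a b with a <? p | p <? b
  ... | yes _ | yes _ = trans (+-cong (integrate-const z ps a p) (integrate-const z ps p b))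
        (solve 4 (λ a p b z → (p :- a) :* z :+ (b :- p) :* z := (b :- a) :* z) refl a p b z)
  ... | yes _ | no  _ = integrate-const z ps a b
  ... | no  _ | _     = integrate-const z ps a b

  integrate-sum : ∀ {n} (g : Fin n → Carrier → Carrier) ps a b →
                  integrate (λ θ → sum (λ i → g i θ)) ps a b ≈ sum (λ i → integrate (g i) ps a b)
  integrate-sum {zero}  g ps a b = trans (integrate-const 0# ps a b) (zeroʳ _)
  integrate-sum {suc n} g ps a b = trans (integrate-+ _ _ ps a b) (+-congˡ (integrate-sum (g ∘ suc) ps a b))

  module _ {g : Carrier → Carrier} where

    pc-++ʳ : ∀ ps {qs a b} → PiecewiseConstant g qs a b → PiecewiseConstant g (ps ++ qs) a b
    pc-++ʳ ps pc i i′ same = pc i i′ (All.++⁻ʳ ps same)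

    pc-below : ∀ {p ps a b} → p < b → PiecewiseConstant g (p ∷ ps) a b → PiecewiseConstant g ps a p
    pc-below p<b pc (l , r) (l′ , r′) same =
      pc (l , <-trans r p<b) (l′ , <-trans r′ p<b) (inj₂ (r , r′) ∷ same)

    pc-above : ∀ {p ps a b} → a < p → PiecewiseConstant g (p ∷ ps) a b → PiecewiseConstant g ps p b
    pc-above a<p pc (l , r) (l′ , r′) same =
      pc (<-trans a<p l , r) (<-trans a<p l′ , r′) (inj₁ (l , l′) ∷ same)

    pc-skip : ∀ {p ps a b} → ¬ (a < p × p < b) → PiecewiseConstant g (p ∷ ps) a b → PiecewiseConstant g ps a b
    pc-skip {p} {ps} {a} {b} out pc (l , r) (l′ , r′) same with a <? p
    ... | yes a<p = pc (l , r) (l′ , r′) (inj₂ (<-≤-trans r b≤p , <-≤-trans r′ b≤p) ∷ same)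
      where b≤p = ≮⇒≥ (λ p<b → out (a<p , p<b))
    ... | no a≮p = pc (l , r) (l′ , r′) (inj₁ (≤-<-trans (≮⇒≥ a≮p) l , ≤-<-trans (≮⇒≥ a≮p) l′) ∷ same)

    pc-sub : ∀ {ps a b a′ b′} → a ≤ a′ → b′ ≤ b → PiecewiseConstant g ps a b → PiecewiseConstant g ps a′ b′
    pc-sub a≤a′ b′≤b pc (l , r) (l′ , r′) =
      pc (≤-<-trans a≤a′ l , <-≤-trans r b′≤b) (≤-<-trans a≤a′ l′ , <-≤-trans r′ b′≤b)

  module _ {g : Carrier → Carrier} (g-cong : ∀ {θ θ′} → θ ≈ θ′ → g θ ≈ g θ′) where
    open import Relation.Binary.Reasoning.Setoid setoid

    private
      I : List Carrier → Carrier → Carrier → Carrier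
      I = integrate g

    -- Splitting moves the sampling points, so additivity rests on constancy: with no break left,
    -- all three midpoints see the same value. Otherwise the first break `q` either cuts the piece
    -- to the left or to the right of `p`, coincides with `p` and performs the split itself, or
    -- falls outside the interval.
    integrate-split : ∀ ps {a p b} → a < p → p < b → PiecewiseConstant g ps a b →
                      I ps a b ≈ I ps a p + I ps p b
    integrate-split [] {a} {p} {b} a<p p<b pc = begin
      (b - a) * g m                                ≈⟨ solve 4 (λ a p b v → (b :- a) :* v := (p :- a) :* v :+ (b :- p) :* v) refl a p b (g m) ⟩
      (p - a) * g m + (b - p) * g m                ≈⟨ +-cong (*-congˡ (pc m∈ (a<mid a<p , <-trans (mid<b a<p) p<b) []))
                                                             (*-congˡ (pc m∈ (<-trans a<p (a<mid p<b) , mid<b p<b) [])) ⟩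
      (p - a) * g ((a + p) * ½) + (b - p) * g ((p + b) * ½) ∎
      where
      m = (a + b) * ½
      m∈ : a < m × m < b
      m∈ = a<mid (<-trans a<p p<b) , mid<b (<-trans a<p p<b)
    integrate-split (q ∷ ps) {a} {p} {b} a<p p<b pc = case compare q p of λ where
      (tri≈ _ q≈p _) → begin
          I (q ∷ ps) a b                    ≡⟨ integrate-cut g ps (<-respʳ-≈ (sym q≈p) a<p) (<-respˡ-≈ (sym q≈p) p<b) ⟩
          I ps a q + I ps q b               ≈⟨ +-cong (integrate-cong g-cong (pointwise-refl ps) refl q≈p)
                                                      (integrate-cong g-cong (pointwise-refl ps) q≈p refl) ⟩
          I ps a p + I ps p b               ≡⟨ ≡.cong₂ _+_ (integrate-skip g ps (irrefl q≈p ∘ proj₂))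
                                                           (integrate-skip g ps (irrefl (sym q≈p) ∘ proj₁)) ⟨
          I (q ∷ ps) a p + I (q ∷ ps) p b   ∎
      (tri< q<p _ p≮q) → case a <? q of λ where
        (yes a<q) → begin
          I (q ∷ ps) a b                    ≡⟨ integrate-cut g ps a<q (<-trans q<p p<b) ⟩
          I ps a q + I ps q b               ≈⟨ +-congˡ (integrate-split ps q<p p<b (pc-above a<q pc)) ⟩
          I ps a q + (I ps q p + I ps p b)  ≈⟨ +-assoc _ _ _ ⟨
          I ps a q + I ps q p + I ps p b    ≡⟨ ≡.cong₂ _+_ (integrate-cut g ps a<q q<p) (integrate-skip g ps (p≮q ∘ proj₁)) ⟨
          I (q ∷ ps) a p + I (q ∷ ps) p b   ∎
        (no a≮q) → begin
          I (q ∷ ps) a b                    ≡⟨ integrate-skip g ps (a≮q ∘ proj₁) ⟩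
          I ps a b                          ≈⟨ integrate-split ps a<p p<b (pc-skip (a≮q ∘ proj₁) pc) ⟩
          I ps a p + I ps p b               ≡⟨ ≡.cong₂ _+_ (integrate-skip g ps (a≮q ∘ proj₁)) (integrate-skip g ps (p≮q ∘ proj₁)) ⟨
          I (q ∷ ps) a p + I (q ∷ ps) p b   ∎
      (tri> q≮p _ p<q) → case q <? b of λ where
        (yes q<b) → begin
          I (q ∷ ps) a b                    ≡⟨ integrate-cut g ps (<-trans a<p p<q) q<b ⟩
          I ps a q + I ps q b               ≈⟨ +-congʳ (integrate-split ps a<p p<q (pc-below q<b pc)) ⟩
          I ps a p + I ps p q + I ps q b    ≈⟨ +-assoc _ _ _ ⟩
          I ps a p + (I ps p q + I ps q b)  ≡⟨ ≡.cong₂ _+_ (integrate-skip g ps (q≮p ∘ proj₂)) (integrate-cut g ps p<q q<b) ⟨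
          I (q ∷ ps) a p + I (q ∷ ps) p b   ∎
        (no q≮b) → begin
          I (q ∷ ps) a b                    ≡⟨ integrate-skip g ps (q≮b ∘ proj₂) ⟩
          I ps a b                          ≈⟨ integrate-split ps a<p p<b (pc-skip (q≮b ∘ proj₂) pc) ⟩
          I ps a p + I ps p b               ≡⟨ ≡.cong₂ _+_ (integrate-skip g ps (q≮p ∘ proj₂)) (integrate-skip g ps (q≮b ∘ proj₂)) ⟨
          I (q ∷ ps) a p + I (q ∷ ps) p b   ∎

    -- Since `qs` alone already resolves `g`, each cut made by `ps` is undone by `integrate-split`.
    integrate-++ʳ : ∀ ps qs {a b} → PiecewiseConstant g qs a b → I (ps ++ qs) a b ≈ I qs a b
    integrate-++ʳ []       qs pc = refl
    integrate-++ʳ (p ∷ ps) qs {a} {b} pc with a <? p | p <? b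
    ... | yes a<p | yes p<b = trans (sym (integrate-split (ps ++ qs) a<p p<b (pc-++ʳ ps pc))) (integrate-++ʳ ps qs pc)
    ... | yes _   | no  _   = integrate-++ʳ ps qs pc
    ... | no  _   | _       = integrate-++ʳ ps qs pc

    -- Once the cuts of `ps` are made, `g` is constant on each piece, and there `integrate-++ʳ` with
    -- an empty list of needed breaks discards `qs`.
    integrate-++ˡ : ∀ ps qs {a b} → PiecewiseConstant g ps a b → I (ps ++ qs) a b ≈ I ps a b
    integrate-++ˡ [] qs {a} {b} pc = begin
      I qs a b            ≡⟨ ≡.cong (λ l → I l a b) (++-identityʳ qs) ⟨
      I (qs ++ []) a b    ≈⟨ integrate-++ʳ qs [] pc ⟩
      I [] a b            ∎
    integrate-++ˡ (p ∷ ps) qs {a} {b} pc with (a <? p) ×-dec (p <? b)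
    ... | yes (a<p , p<b) = begin
      I (p ∷ ps ++ qs) a b                   ≡⟨ integrate-cut g (ps ++ qs) a<p p<b ⟩
      I (ps ++ qs) a p + I (ps ++ qs) p b    ≈⟨ +-cong (integrate-++ˡ ps qs (pc-below p<b pc)) (integrate-++ˡ ps qs (pc-above a<p pc)) ⟩
      I ps a p + I ps p b                    ≡⟨ integrate-cut g ps a<p p<b ⟨
      I (p ∷ ps) a b                         ∎
    ... | no out = begin
      I (p ∷ ps ++ qs) a b                   ≡⟨ integrate-skip g (ps ++ qs) out ⟩
      I (ps ++ qs) a b                       ≈⟨ integrate-++ˡ ps qs (pc-skip out pc) ⟩
      I ps a b                               ≡⟨ integrate-skip g ps out ⟨
      I (p ∷ ps) a b                         ∎

    -- Both lists agree with their common refinement `ps ++ qs`.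
    integrate-breaks : ∀ ps qs {a b} → PiecewiseConstant g ps a b → PiecewiseConstant g qs a b →
                       I ps a b ≈ I qs a b
    integrate-breaks ps qs pc pc′ = trans (sym (integrate-++ˡ ps qs pc)) (integrate-++ʳ ps qs pc′)

    -- Reflection carries midpoints to midpoints and exchanges the two sides of each cut, so the sum
    -- is the same up to order.
    integrate-reflect : ∀ ps a b →
      integrate (λ θ → g (1# - θ)) (map (λ p → 1# - p) ps) (1# - b) (1# - a) ≈ I ps a b
    integrate-reflect [] a b = *-cong
      (solve 2 (λ a b → con (+ 1) :- a :- (con (+ 1) :- b) := b :- a) refl a b)
      (g-cong (begin
        -- `½` is an atom for the solver; writing `1#` through `½ + ½` turns the claim into a
        -- polynomial identity in that atom.
        1# - (1# - b + (1# - a)) * ½     ≈⟨ +-congʳ (trans (sym (*-identityˡ 1#)) (*-cong refl (sym ½+½≈1))) ⟩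
        1# * (½ + ½) - (1# - b + (1# - a)) * ½
          ≈⟨ solve 3 (λ a b h → con (+ 1) :* (h :+ h) :- (con (+ 1) :- b :+ (con (+ 1) :- a)) :* h := (a :+ b) :* h) refl a b ½ ⟩
        (a + b) * ½                      ∎))
    integrate-reflect (p ∷ ps) a b with (a <? p) ×-dec (p <? b)
    ... | yes (a<p , p<b) = begin
      integrate g′ (map r (p ∷ ps)) (r b) (r a)    ≡⟨ integrate-cut g′ (map r ps) (1-reverses-< p<b) (1-reverses-< a<p) ⟩
      integrate g′ (map r ps) (r b) (r p) + integrate g′ (map r ps) (r p) (r a)
                                                   ≈⟨ +-cong (integrate-reflect ps p b) (integrate-reflect ps a p) ⟩
      I ps p b + I ps a p                          ≈⟨ +-comm _ _ ⟩
      I ps a p + I ps p b                          ≡⟨ integrate-cut g ps a<p p<b ⟨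
      I (p ∷ ps) a b                               ∎
      where
      r = λ θ → 1# - θ
      g′ = λ θ → g (1# - θ)
    ... | no out = begin
      integrate g′ (map r (p ∷ ps)) (r b) (r a)    ≡⟨ integrate-skip g′ (map r ps) (λ (l , u) → out (r-reflects-< u , r-reflects-< l)) ⟩
      integrate g′ (map r ps) (r b) (r a)          ≈⟨ integrate-reflect ps a b ⟩
      I ps a b                                     ≡⟨ integrate-skip g ps out ⟨
      I (p ∷ ps) a b                               ∎
      where
      r = λ θ → 1# - θ
      g′ = λ θ → g (1# - θ)
      r-reflects-< : ∀ {x y} → r y < r x → x < y
      r-reflects-< {x} {y} lt = <-respˡ-≈ (1-[1-x]≈x x) (<-respʳ-≈ (1-[1-x]≈x y) (1-reverses-< lt))

    pc-reflect : ∀ {ps a b} → PiecewiseConstant g ps a b →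
                 PiecewiseConstant (λ θ → g (1# - θ)) (map (λ p → 1# - p) ps) (1# - b) (1# - a)
    pc-reflect {ps} {a} {b} pc (l , u) (l′ , u′) same =
      pc (flip-> u , flip-< l) (flip-> u′ , flip-< l′) (All.map side (All.map⁻ same))
      where
      flip-> : ∀ {x θ} → θ < 1# - x → x < 1# - θ
      flip-> {x} lt = <-respˡ-≈ (1-[1-x]≈x x) (1-reverses-< lt)
      flip-< : ∀ {x θ} → 1# - x < θ → 1# - θ < x
      flip-< {x} lt = <-respʳ-≈ (1-[1-x]≈x x) (1-reverses-< lt)
      side : ∀ {p θ θ′} → SameSide (1# - p) θ θ′ → SameSide p (1# - θ) (1# - θ′)
      side (inj₁ (s , s′)) = inj₂ (flip-< s , flip-< s′)
      side (inj₂ (s , s′)) = inj₁ (flip-> s , flip-> s′)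

-- Modular minorants of a submodular function.

module ModularFunctions {c ℓ₁ ℓ₂} (K : OrderedField c ℓ₁ ℓ₂) where
  open OrderedField K hiding (zero)
  open MultiwayPartition K
  open IntegerSolver commutativeRing
  open OrderedFieldProperties K

  indicator : Bool → Carrier
  indicator b = if b then 1# else 0#

  indicator-∈ : ∀ {n} {S : Subset n} {l} → l ∈ S → indicator (lookup S l) ≈ 1#
  indicator-∈ l∈S = reflexive (≡.cong indicator ([]=⇒lookup l∈S))

  indicator-∉ : ∀ {n} {S : Subset n} {l} → l ∉ S → indicator (lookup S l) ≈ 0#
  indicator-∉ {S = S} {l} l∉S with lookup S l in eq
  ... | true  = contradiction (lookup⇒[]= l S eq) l∉S
  ... | false = refl

  -- A modular function vanishing at `⊥`, held as a list of weighted elements so that proofs about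
  -- it follow the order in which `greedy` creates the weights.
  weigh : ∀ {n} → List (Fin n × Carrier) → Subset n → Carrier
  weigh []            S = 0#
  weigh ((l , w) ∷ W) S = indicator (lookup S l) * w + weigh W S

  weigh-∈ : ∀ {n} {l : Fin n} {w} W {S} → l ∈ S → weigh ((l , w) ∷ W) S ≈ w + weigh W S
  weigh-∈ W l∈S = +-congʳ (trans (*-congʳ (indicator-∈ l∈S)) (*-identityˡ _))

  weigh-∉ : ∀ {n} {l : Fin n} {w} W {S} → l ∉ S → weigh ((l , w) ∷ W) S ≈ weigh W S
  weigh-∉ W l∉S = trans (+-congʳ (trans (*-congʳ (indicator-∉ l∉S)) (zeroˡ _))) (+-identityˡ _)

  fill : ∀ {n} → Subset n → List (Fin n) → Subset n
  fill P []       = P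
  fill P (l ∷ ls) = fill (P ∪ ⁅ l ⁆) ls

  ⊆-fill : ∀ {n} (P : Subset n) ls → P ⊆ fill P ls
  ⊆-fill P []       j∈P = j∈P
  ⊆-fill P (l ∷ ls) j∈P = ⊆-fill (P ∪ ⁅ l ⁆) ls (p⊆p∪q ⁅ l ⁆ j∈P)

  ∈-fill : ∀ {n} (P : Subset n) {ls j} → j List.∈ ls → j ∈ fill P ls
  ∈-fill P {l ∷ ls} (here ≡.refl) = ⊆-fill (P ∪ ⁅ l ⁆) ls (q⊆p∪q P ⁅ l ⁆ (x∈⁅x⁆ l))
  ∈-fill P {l ∷ ls} (there j∈ls)  = ∈-fill (P ∪ ⁅ l ⁆) j∈ls

  ∩-insert-∉ : ∀ {n} {S : Subset n} P {l} → l ∉ S → S ∩ (P ∪ ⁅ l ⁆) ≡ S ∩ P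
  ∩-insert-∉ {S = S} P {l} l∉S = ⊆-antisym
    (λ j∈ → let (j∈S , j∈P∪l) = x∈p∩q⁻ S _ j∈ in
      case x∈p∪q⁻ P ⁅ l ⁆ j∈P∪l of λ where
        (inj₁ j∈P) → x∈p∩q⁺ (j∈S , j∈P)
        (inj₂ j∈l) → contradiction (≡.subst (_∈ S) (x∈⁅y⁆⇒x≡y l j∈l) j∈S) l∉S)
    (λ j∈ → let (j∈S , j∈P) = x∈p∩q⁻ S _ j∈ in x∈p∩q⁺ (j∈S , p⊆p∪q ⁅ l ⁆ j∈P))

  ∪-insert-∈ : ∀ {n} {S : Subset n} P {l} → l ∈ S → P ∪ (S ∩ (P ∪ ⁅ l ⁆)) ≡ P ∪ ⁅ l ⁆
  ∪-insert-∈ {S = S} P {l} l∈S = ⊆-antisym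
    (λ j∈ → [ p⊆p∪q ⁅ l ⁆ , p∩q⊆q S _ ]′ (x∈p∪q⁻ P _ j∈))
    (λ j∈ → x∈p∪q⁺ (case x∈p∪q⁻ P ⁅ l ⁆ j∈ of λ where
        (inj₁ j∈P) → inj₁ j∈P
        (inj₂ j∈l) → inj₂ (x∈p∩q⁺ (≡.subst (_∈ S) (≡.sym (x∈⁅y⁆⇒x≡y l j∈l)) l∈S , j∈))))

  ∩-insert : ∀ {n} (S P : Subset n) l → P ∩ (S ∩ (P ∪ ⁅ l ⁆)) ≡ S ∩ P
  ∩-insert S P l = ⊆-antisym
    (λ j∈ → let (j∈P , j∈S∩) = x∈p∩q⁻ P _ j∈ in x∈p∩q⁺ (p∩q⊆p S _ j∈S∩ , j∈P))
    (λ j∈ → let (j∈S , j∈P) = x∈p∩q⁻ S P j∈ in x∈p∩q⁺ (j∈P , x∈p∩q⁺ (j∈S , p⊆p∪q ⁅ l ⁆ j∈P)))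

  ⊆⇒∩≡ : ∀ {n} {S P : Subset n} → P ⊆ S → S ∩ P ≡ P
  ⊆⇒∩≡ {S = S} P⊆S = ⊆-antisym (p∩q⊆q S _) (λ j∈P → x∈p∩q⁺ (P⊆S j∈P , j∈P))

  insert-⊆ : ∀ {n} {S P : Subset n} {l} → P ⊆ S → l ∈ S → P ∪ ⁅ l ⁆ ⊆ S
  insert-⊆ {S = S} {P} {l} P⊆S l∈S j∈ = case x∈p∪q⁻ P ⁅ l ⁆ j∈ of λ where
    (inj₁ j∈P) → P⊆S j∈P
    (inj₂ j∈l) → ≡.subst (_∈ S) (≡.sym (x∈⁅y⁆⇒x≡y l j∈l)) l∈S

  fill-disjoint : ∀ {n} {S : Subset n} P {ls} → All (_∉ S) ls → S ∩ fill P ls ≡ S ∩ P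
  fill-disjoint P []           = ≡.refl
  fill-disjoint P (l∉S ∷ ls∉S) = ≡.trans (fill-disjoint _ ls∉S) (∩-insert-∉ P l∉S)

  module Greedy {n} (f : Subset n → Carrier) where

    -- Edmonds' greedy algorithm: started at `⊥` on an enumeration of the ground set, the marginal
    -- gains give a vertex of the base polytope of `f` minus `f ⊥` when `f` is submodular. The set
    -- `P` collected so far is a parameter for the induction.
    greedy : Subset n → List (Fin n) → List (Fin n × Carrier)
    greedy P []       = []
    greedy P (l ∷ ls) = (l , f (P ∪ ⁅ l ⁆) - f P) ∷ greedy (P ∪ ⁅ l ⁆) ls

    -- Diminishing returns: for `l ∈ S` the gain of `l` over `P` is at most its gain over `S ∩ P`.
    -- This is submodularity for `P` and `S ∩ (P ∪ ⁅ l ⁆)`, whose union is `P ∪ ⁅ l ⁆` and whose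
    -- intersection is `S ∩ P`. Elements outside `S` change neither side, and the gains telescope.
    greedy-≤ : Submodular f → ∀ P ls S → weigh (greedy P ls) S + f (S ∩ P) ≤ f (S ∩ fill P ls)
    greedy-≤ sub P []       S = inj₂ (+-identityˡ _)
    greedy-≤ sub P (l ∷ ls) S with l ∈? S
    ... | yes l∈S = begin
      weigh (greedy P (l ∷ ls)) S + f (S ∩ P)             ≈⟨ +-congʳ (weigh-∈ W l∈S) ⟩
      f P′ - f P + weigh W S + f (S ∩ P)
        ≈⟨ solve 4 (λ x y w u → x :- y :+ w :+ u := w :+ ((x :+ u) :- y)) refl (f P′) (f P) (weigh W S) (f (S ∩ P)) ⟩
      weigh W S + (f P′ + f (S ∩ P) - f P)
        ≡⟨ ≡.cong₂ (λ A B → weigh W S + (f A + f B - f P)) (∪-insert-∈ P l∈S) (∩-insert S P l) ⟨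
      weigh W S + (f (P ∪ (S ∩ P′)) + f (P ∩ (S ∩ P′)) - f P)
        ≤⟨ +-monoʳ-≤ _ (+-monoˡ-≤ _ (sub P (S ∩ P′))) ⟩
      weigh W S + (f P + f (S ∩ P′) - f P)
        ≈⟨ solve 3 (λ w y u → w :+ (y :+ u :- y) := w :+ u) refl (weigh W S) (f P) (f (S ∩ P′)) ⟩
      weigh W S + f (S ∩ P′)                              ≤⟨ greedy-≤ sub P′ ls S ⟩
      f (S ∩ fill P′ ls)                                  ∎
      where
      open ≤-Reasoning
      P′ = P ∪ ⁅ l ⁆
      W = greedy P′ ls
    ... | no l∉S = begin
      weigh (greedy P (l ∷ ls)) S + f (S ∩ P)     ≈⟨ +-congʳ (weigh-∉ (greedy P′ ls) l∉S) ⟩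
      weigh (greedy P′ ls) S + f (S ∩ P)          ≡⟨ ≡.cong (λ A → weigh (greedy P′ ls) S + f A) (∩-insert-∉ P l∉S) ⟨
      weigh (greedy P′ ls) S + f (S ∩ P′)         ≤⟨ greedy-≤ sub P′ ls S ⟩
      f (S ∩ fill P′ ls)                          ∎
      where
      open ≤-Reasoning
      P′ = P ∪ ⁅ l ⁆

    greedy-disjoint : ∀ P {ls S} → All (_∉ S) ls → weigh (greedy P ls) S ≈ 0#
    greedy-disjoint P {[]}     []           = refl
    greedy-disjoint P {l ∷ ls} (l∉S ∷ ls∉S) =
      trans (weigh-∉ (greedy (P ∪ ⁅ l ⁆) ls) l∉S) (greedy-disjoint (P ∪ ⁅ l ⁆) ls∉S)

    -- Tightness needs the elements of S to come before all others in the list.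
    greedy-≈ : ∀ P {ls S} → P ⊆ S → AllPairs (λ l l′ → l′ ∈ S → l ∈ S) ls →
               weigh (greedy P ls) S + f P ≈ f (S ∩ fill P ls)
    greedy-≈ P {[]} P⊆S [] = trans (+-identityˡ _) (reflexive (≡.cong f (≡.sym (⊆⇒∩≡ P⊆S))))
    greedy-≈ P {l ∷ ls} {S} P⊆S (l≼ls ∷ sorted) with l ∈? S
    ... | yes l∈S = begin
      weigh (greedy P (l ∷ ls)) S + f P           ≈⟨ +-congʳ (weigh-∈ W l∈S) ⟩
      f P′ - f P + weigh W S + f P                ≈⟨ solve 3 (λ x y w → x :- y :+ w :+ y := w :+ x) refl (f P′) (f P) (weigh W S) ⟩
      weigh W S + f P′                            ≈⟨ greedy-≈ P′ (insert-⊆ P⊆S l∈S) sorted ⟩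
      f (S ∩ fill P′ ls)                          ∎
      where
      open import Relation.Binary.Reasoning.Setoid setoid
      P′ = P ∪ ⁅ l ⁆
      W = greedy P′ ls
    ... | no l∉S = begin
      weigh (greedy P (l ∷ ls)) S + f P           ≈⟨ +-congʳ (greedy-disjoint P ls∉S) ⟩
      0# + f P                                    ≈⟨ +-identityˡ _ ⟩
      f P                                         ≡⟨ ≡.cong f (≡.trans (fill-disjoint P ls∉S) (⊆⇒∩≡ P⊆S)) ⟨
      f (S ∩ fill P (l ∷ ls))                     ∎
      where
      open import Relation.Binary.Reasoning.Setoid setoid
      ls∉S : All (_∉ S) (l ∷ ls)
      ls∉S = l∉S ∷ All.map (λ imp → l∉S ∘ imp) l≼ls

  module Support {n} (f : Subset n → Carrier) (sub : Submodular f) (key : Fin n → Carrier) where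
    open Greedy f
    open import Data.List.Sort (On.decTotalOrder ≤-decTotalOrder key) using (sort; sort-↭; sort-↗)

    order : List (Fin n)
    order = sort (allFin n)

    weights : List (Fin n × Carrier)
    weights = greedy ⊥ order

    fill-order : fill ⊥ order ≡ ⊤
    fill-order = ⊆-antisym ⊆⊤ (λ {j} _ → ∈-fill ⊥ (∈-resp-↭ (↭-sym (sort-↭ (allFin n))) (∈-allFin j)))

    weigh-≤ : ∀ S → weigh weights S + f ⊥ ≤ f S
    weigh-≤ S = begin
      weigh weights S + f ⊥           ≡⟨ ≡.cong (λ A → weigh weights S + f A) (∩-zeroʳ S) ⟨
      weigh weights S + f (S ∩ ⊥)     ≤⟨ greedy-≤ sub ⊥ order S ⟩
      f (S ∩ fill ⊥ order)            ≡⟨ ≡.cong f (≡.trans (≡.cong (S ∩_) fill-order) (∩-identityʳ S)) ⟩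
      f S                             ∎
      where open ≤-Reasoning

    -- The hypothesis closes `S` under smaller keys and under ties, so `S` is an initial segment of
    -- the sorted order however ties were broken, and on initial segments the gains telescope
    -- exactly.
    weigh-≈ : ∀ S → (∀ {l l′} → key l ≤ key l′ → l′ ∈ S → l ∈ S) → weigh weights S + f ⊥ ≈ f S
    weigh-≈ S down = begin
      weigh weights S + f ⊥           ≈⟨ greedy-≈ ⊥ ⊥⊆ (AllPairs.map (λ le → down le) (Linked⇒AllPairs ≤-trans (sort-↗ (allFin n)))) ⟩
      f (S ∩ fill ⊥ order)            ≡⟨ ≡.cong f (≡.trans (≡.cong (S ∩_) fill-order) (∩-identityʳ S)) ⟩
      f S                             ∎
      where open import Relation.Binary.Reasoning.Setoid setoid

-- Level sets and the partition produced by rounding.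

∈-⋃⁺ : ∀ {n k} (B : Fin k → Subset n) {j} i → j ∈ B i → j ∈ ⋃ (tabulate B)
∈-⋃⁺ B zero    j∈ = p⊆p∪q _ j∈
∈-⋃⁺ B (suc i) j∈ = q⊆p∪q (B zero) _ (∈-⋃⁺ (B ∘ suc) i j∈)

∈-⋃⁻ : ∀ {n k} (B : Fin k → Subset n) {j} → j ∈ ⋃ (tabulate B) → ∃ λ i → j ∈ B i
∈-⋃⁻ {k = zero}  B j∈ = contradiction j∈ ∉⊥
∈-⋃⁻ {k = suc k} B j∈ with x∈p∪q⁻ (B zero) _ j∈
... | inj₁ j∈B₀ = zero , j∈B₀
... | inj₂ j∈⋃  = let (i , j∈Bᵢ) = ∈-⋃⁻ (B ∘ suc) j∈⋃ in suc i , j∈Bᵢ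

module RoundingProperties {c ℓ₁ ℓ₂} (K : OrderedField c ℓ₁ ℓ₂) where
  open OrderedField K hiding (zero)
  open Expectation K
  open MultiwayPartition K
  open IntegerSolver commutativeRing
  open OrderedFieldProperties K
  open Integration K
  open ModularFunctions K
  open import Algebra.Properties.CommutativeMonoid.Sum +-commutativeMonoid using (∑-distrib-+; sum-cong-≋)

  ∈-above⁺ : ∀ {n} {y : Fin n → Carrier} {θ j} → θ < y j → j ∈ above y θ
  ∈-above⁺ {y = y} {θ} {j} θ<y = lookup⇒[]= j _ (≡.trans (lookup∘tabulate _ j) (dec-true (θ <? y j) θ<y))

  ∈-above⁻ : ∀ {n} {y : Fin n → Carrier} {θ j} → j ∈ above y θ → θ < y j
  ∈-above⁻ {y = y} {θ} {j} j∈ with θ <? y j | ≡.trans (≡.sym (lookup∘tabulate (λ j → does (θ <? y j)) j)) ([]=⇒lookup j∈)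
  ... | yes θ<y | _  = θ<y
  ... | no  _   | ()

  above-≈ : ∀ {n} (y : Fin n → Carrier) {θ θ′} → θ ≈ θ′ → above y θ ≡ above y θ′
  above-≈ y θ≈θ′ = tabulateᵥ-cong (λ j → does-⇔ (mk⇔ (<-respˡ-≈ θ≈θ′) (<-respˡ-≈ (sym θ≈θ′))) (_ <? y j) (_ <? y j))

  module _ {n k} (x : Fin k → Fin n → Carrier) where
    open Rounding x

    ∈-U⁻ : ∀ {θ j} → j ∈ U θ → ∀ i → j ∉ A θ i
    ∈-U⁻ {θ} j∈U i j∈A = x∈∁p⇒x∉p j∈U (∈-⋃⁺ (A θ) i j∈A)

    ∈-U⁺ : ∀ {θ j} → (∀ i → j ∉ A θ i) → j ∈ U θ
    ∈-U⁺ {θ} j∉A = x∉p⇒x∈∁p (λ j∈⋃ → let (i , j∈A) = ∈-⋃⁻ (A θ) j∈⋃ in j∉A i j∈A)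

    A⊎U : ∀ θ j → (∃ λ i → j ∈ A θ i) ⊎ j ∈ U θ
    A⊎U θ j with j ∈? ⋃ (tabulate (A θ))
    ... | yes j∈⋃ = inj₁ (∈-⋃⁻ (A θ) j∈⋃)
    ... | no  j∉⋃ = inj₂ (x∉p⇒x∈∁p j∉⋃)

    rounded-same : ∀ θ i → rounded θ i i ≡ A θ i ∪ U θ
    rounded-same θ i rewrite dec-true (i Fin.≟ i) ≡.refl = ≡.refl

    rounded-other : ∀ θ {i′ i} → i ≢ i′ → rounded θ i′ i ≡ A θ i
    rounded-other θ {i′} {i} i≢i′ rewrite dec-false (i Fin.≟ i′) i≢i′ = ≡.refl

    A⊆rounded : ∀ θ i′ i → A θ i ⊆ rounded θ i′ i
    A⊆rounded θ i′ i j∈A with i Fin.≟ i′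
    ... | yes _ = p⊆p∪q _ j∈A
    ... | no  _ = j∈A

    ∈-rounded⁻ : ∀ θ i′ i {j} → j ∈ rounded θ i′ i → j ∈ A θ i ⊎ (i ≡ i′ × j ∈ U θ)
    ∈-rounded⁻ θ i′ i j∈ with i Fin.≟ i′
    ... | no  _    = inj₁ j∈
    ... | yes i≡i′ with x∈p∪q⁻ (A θ i) _ j∈
    ...   | inj₁ j∈A = inj₁ j∈A
    ...   | inj₂ j∈U = inj₂ (i≡i′ , j∈U)

    module _ (0≤x : ∀ i j → 0# ≤ x i j) (∑x≈1 : ∀ j → sum (λ i → x i j) ≈ 1#) where

      x≤1 : ∀ i j → x i j ≤ 1#
      x≤1 i j = ≤-trans (term≤sum (λ i → 0≤x i j) i) (inj₂ (∑x≈1 j))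

      -- Two distinct terminals would take more than `θ + θ′`, hence more than 1, from the column of
      -- `j`. Applied with `θ′ = θ` and with the reflected pair `1# - θ`, `θ`.
      levels-disjoint : ∀ {θ θ′ i i′ j} → 1# ≤ θ + θ′ → j ∈ A θ i → j ∈ A θ′ i′ → i ≡ i′
      levels-disjoint {θ} {θ′} {i} {i′} {j} 1≤ j∈ j∈′ with i Fin.≟ i′
      ... | yes i≡i′ = i≡i′
      ... | no  i≢i′ = contradiction (begin-strict
        1#               ≤⟨ 1≤ ⟩
        θ + θ′           <⟨ +-mono-< (∈-above⁻ j∈) (∈-above⁻ j∈′) ⟩
        x i j + x i′ j   ≤⟨ pair≤sum (λ i → 0≤x i j) i i′ i≢i′ ⟩
        sum (λ i → x i j) ≈⟨ ∑x≈1 j ⟩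
        1#               ∎) (irrefl refl)
        where open ≤-Reasoning

      rounded-isPartition : ∀ {θ} → ½ < θ → ∀ i′ → IsPartition (rounded θ i′)
      rounded-isPartition {θ} ½<θ i′ = record { disjoint = disjoint ; covers = covers }
        where
        disjoint : ∀ {i l} → i ≢ l → Empty (rounded θ i′ i ∩ rounded θ i′ l)
        disjoint {i} {l} i≢l (j , j∈) =
          let (j∈i , j∈l) = x∈p∩q⁻ (rounded θ i′ i) _ j∈
          in case ∈-rounded⁻ θ i′ i j∈i , ∈-rounded⁻ θ i′ l j∈l of λ where
            (inj₁ p         , inj₁ q)         → i≢l (levels-disjoint (1≤θ+θ ½<θ) p q)
            (inj₁ p         , inj₂ (_ , q))   → ∈-U⁻ q i p
            (inj₂ (_ , p)   , inj₁ q)         → ∈-U⁻ p l q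
            (inj₂ (i≡ , _)  , inj₂ (l≡ , _))  → i≢l (≡.trans i≡ (≡.sym l≡))
        covers : ∀ j → ∃ λ i → j ∈ rounded θ i′ i
        covers j with A⊎U θ j
        ... | inj₁ (i , j∈A) = i , A⊆rounded θ i′ i j∈A
        ... | inj₂ j∈U       = i′ , ≡.subst (j ∈_) (≡.sym (rounded-same θ i′)) (q⊆p∪q (A θ i′) _ j∈U)

  -- Double counting for families of sets.

  total : ∀ {n k} → List (Fin n × Carrier) → (Fin k → Subset n) → Carrier
  total W B = sum (λ i → weigh W (B i))

  count : ∀ {n k} → (Fin k → Subset n) → Fin n → Carrier
  count B l = sum (λ i → indicator (lookup (B i) l))

  -- Exchanging the sums makes each element contribute its weight times its multiplicity in the
  -- family, which reduces identities between totals to identities between multiplicities.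
  total-∷ : ∀ {n k} l w W (B : Fin k → Subset n) → total ((l , w) ∷ W) B ≈ count B l * w + total W B
  total-∷ l w W B = trans (∑-distrib-+ (λ i → indicator (lookup (B i) l) * w) (λ i → weigh W (B i)))
    (+-congʳ (*-distribʳ-sum w (λ i → indicator (lookup (B i) l))))

  count-none : ∀ {n k} (B : Fin k → Subset n) {l} → (∀ i → l ∉ B i) → count B l ≈ 0#
  count-none {k = k} B l∉ = trans (sum-cong-≋ (λ i → indicator-∉ (l∉ i))) (trans (sum-const k 0#) (zeroʳ _))

  count-unique : ∀ {n k} (B : Fin k → Subset n) {l} i → l ∈ B i → (∀ {i′} → l ∈ B i′ → i′ ≡ i) → count B l ≈ 1#
  count-unique B i l∈ uniq = trans (sum-single i (λ i′ i′≢i → indicator-∉ (i′≢i ∘ uniq))) (indicator-∈ l∈)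

  count-∩-∈ : ∀ {n k} (B : Fin k → Subset n) {S l} → l ∈ S → count (λ i → S ∩ B i) l ≈ count B l
  count-∩-∈ B {S} {l} l∈S = sum-cong-≋ (λ i → eq i)
    where
    eq : ∀ i → indicator (lookup (S ∩ B i) l) ≈ indicator (lookup (B i) l)
    eq i with l ∈? B i
    ... | yes l∈B = trans (indicator-∈ (x∈p∩q⁺ (l∈S , l∈B))) (sym (indicator-∈ l∈B))
    ... | no  l∉B = trans (indicator-∉ (l∉B ∘ p∩q⊆q S _)) (sym (indicator-∉ l∉B))

  -- k = m + 2, so that k − 2 is again a numeral and visibly nonnegative.
  module Analysis {n m} (x : Fin (suc (suc m)) → Fin n → Carrier)
                   (0≤x : ∀ i j → 0# ≤ x i j) (∑x≈1 : ∀ j → sum (λ i → x i j) ≈ 1#) where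
    open Rounding x

    private
      k : ℕ
      k = suc (suc m)
      M κ : Carrier
      M = fromℕ m
      κ = fromℕ k

    -- Multiplicities in the level sets at θ and 1 - θ.

    module _ {θ} (½<θ : ½ < θ) where

      D : Fin k → Subset n
      D = A (1# - θ)

      1≤δ+θ : 1# ≤ (1# - θ) + θ
      1≤δ+θ = inj₂ (solve 1 (λ θ → con (+ 1) := con (+ 1) :- θ :+ θ) refl θ)

      A⊆D : ∀ i → A θ i ⊆ D i
      A⊆D i j∈A = ∈-above⁺ (<-trans 1-θ<θ (∈-above⁻ j∈A))
        where
        1-θ<θ : 1# - θ < θ
        1-θ<θ = <-trans (<-respʳ-≈ 1-½≈½ (1-reverses-< ½<θ)) ½<θ

      -- If `l ∈ U θ`, then `count (A θ) l` is 0 and both sides are `(1# + M) * count D l`, whatever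
      -- that multiplicity is. Otherwise `l` lies in exactly one `A θ i` and, by `levels-disjoint`,
      -- in exactly one `D i`, and both sides are `M`. The shape is chosen so that the `U θ` term
      -- cancels the one produced by uncrossing.
      count-identity : ∀ l →
        M * count D l + count (λ i → U θ ∩ D i) l ≈
        κ * indicator (lookup (U θ) l) + M + (1# + M) * (count D l + count (A θ) l - (1# + 1#))
      count-identity l with A⊎U x θ l
      ... | inj₂ l∈U = begin
        M * count D l + count (λ i → U θ ∩ D i) l  ≈⟨ +-congˡ (count-∩-∈ D l∈U) ⟩
        M * count D l + count D l
          ≈⟨ solve 2 (λ M a → M :* a :+ a := (con (+ 1) :+ (con (+ 1) :+ M)) :* con (+ 1) :+ M :+ (con (+ 1) :+ M) :* (a :+ con (+ 0) :- (con (+ 1) :+ con (+ 1)))) refl M (count D l) ⟩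
        κ * 1# + M + (1# + M) * (count D l + 0# - (1# + 1#))
          ≈⟨ +-cong (+-congʳ (*-congˡ (indicator-∈ l∈U))) (*-congˡ (+-congʳ (+-congˡ (count-none (A θ) (∈-U⁻ x l∈U))))) ⟨
        κ * indicator (lookup (U θ) l) + M + (1# + M) * (count D l + count (A θ) l - (1# + 1#)) ∎
        where open import Relation.Binary.Reasoning.Setoid setoid
      ... | inj₁ (i , l∈A) = begin
        M * count D l + count (λ i → U θ ∩ D i) l
          ≈⟨ +-cong (*-congˡ count-D) (count-none (λ i → U θ ∩ D i) (λ _ → l∉U ∘ p∩q⊆p (U θ) _)) ⟩
        M * 1# + 0#
          ≈⟨ solve 1 (λ M → M :* con (+ 1) :+ con (+ 0) := (con (+ 1) :+ (con (+ 1) :+ M)) :* con (+ 0) :+ M :+ (con (+ 1) :+ M) :* (con (+ 1) :+ con (+ 1) :- (con (+ 1) :+ con (+ 1)))) refl M ⟩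
        κ * 0# + M + (1# + M) * (1# + 1# - (1# + 1#))
          ≈⟨ +-cong (+-congʳ (*-congˡ (indicator-∉ l∉U))) (*-congˡ (+-congʳ (+-cong count-D count-A))) ⟨
        κ * indicator (lookup (U θ) l) + M + (1# + M) * (count D l + count (A θ) l - (1# + 1#)) ∎
        where
        open import Relation.Binary.Reasoning.Setoid setoid
        l∉U : l ∉ U θ
        l∉U l∈U = ∈-U⁻ x l∈U i l∈A
        count-D : count D l ≈ 1#
        count-D = count-unique D i (A⊆D i l∈A) (λ l∈D → levels-disjoint x 0≤x ∑x≈1 1≤δ+θ l∈D l∈A)
        count-A : count (A θ) l ≈ 1#
        count-A = count-unique (A θ) i l∈A (λ l∈A′ → levels-disjoint x 0≤x ∑x≈1 (1≤θ+θ ½<θ) l∈A′ l∈A)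

      -- Linear in the weights, hence `count-identity` summed over the elements; its constant terms
      -- become multiples of `weigh W ⊤`.
      total-identity : ∀ W →
        M * total W D + total W (λ i → U θ ∩ D i) ≈
        κ * weigh W (U θ) + M * weigh W ⊤ + (1# + M) * (total W D + total W (A θ) - (weigh W ⊤ + weigh W ⊤))
      total-identity [] = begin
        M * total [] D + total [] (λ i → U θ ∩ D i)  ≈⟨ +-cong (*-congˡ ∑0) ∑0 ⟩
        M * 0# + 0#
          ≈⟨ solve 1 (λ M → M :* con (+ 0) :+ con (+ 0) := (con (+ 1) :+ (con (+ 1) :+ M)) :* con (+ 0) :+ M :* con (+ 0) :+ (con (+ 1) :+ M) :* (con (+ 0) :+ con (+ 0) :- (con (+ 0) :+ con (+ 0)))) refl M ⟩
        κ * 0# + M * 0# + (1# + M) * (0# + 0# - (0# + 0#))  ≈⟨ +-congˡ (*-congˡ (+-congʳ (+-cong ∑0 ∑0))) ⟨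
        κ * 0# + M * 0# + (1# + M) * (total [] D + total [] (A θ) - (0# + 0#)) ∎
        where
        open import Relation.Binary.Reasoning.Setoid setoid
        ∑0 : sum {k} (λ _ → 0#) ≈ 0#
        ∑0 = trans (sum-const k 0#) (zeroʳ _)
      total-identity ((l , w) ∷ W) = begin
        M * total W′ D + total W′ UD   ≈⟨ +-cong (*-congˡ (total-∷ l w W D)) (total-∷ l w W UD) ⟩
        M * (a * w + total W D) + (d * w + total W UD)
          ≈⟨ solve 6 (λ M a d w s t → M :* (a :* w :+ s) :+ (d :* w :+ t) := (M :* a :+ d) :* w :+ (M :* s :+ t)) refl M a d w (total W D) (total W UD) ⟩
        (M * a + d) * w + (M * total W D + total W UD)
          ≈⟨ +-cong (*-congʳ (count-identity l)) (total-identity W) ⟩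
        (κ * u + M + (1# + M) * (a + b - (1# + 1#))) * w
          + (κ * weigh W (U θ) + M * weigh W ⊤ + (1# + M) * (total W D + total W (A θ) - (weigh W ⊤ + weigh W ⊤)))
          ≈⟨ solve 9 (λ M a b u w zU zT s t →
               ((con (+ 1) :+ (con (+ 1) :+ M)) :* u :+ M :+ (con (+ 1) :+ M) :* (a :+ b :- (con (+ 1) :+ con (+ 1)))) :* w
               :+ ((con (+ 1) :+ (con (+ 1) :+ M)) :* zU :+ M :* zT :+ (con (+ 1) :+ M) :* (s :+ t :- (zT :+ zT)))
               := (con (+ 1) :+ (con (+ 1) :+ M)) :* (u :* w :+ zU) :+ M :* (w :+ zT)
                  :+ (con (+ 1) :+ M) :* ((a :* w :+ s) :+ (b :* w :+ t) :- ((w :+ zT) :+ (w :+ zT))))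
               refl M a b u w (weigh W (U θ)) (weigh W ⊤) (total W D) (total W (A θ)) ⟩
        κ * (u * w + weigh W (U θ)) + M * (w + weigh W ⊤)
          + (1# + M) * ((a * w + total W D) + (b * w + total W (A θ)) - ((w + weigh W ⊤) + (w + weigh W ⊤)))
          ≈⟨ +-cong (+-congˡ (*-congˡ z⊤)) (*-congˡ (+-cong (+-cong (total-∷ l w W D) (total-∷ l w W (A θ))) (-‿cong (+-cong z⊤ z⊤)))) ⟨
        κ * weigh W′ (U θ) + M * weigh W′ ⊤ + (1# + M) * (total W′ D + total W′ (A θ) - (weigh W′ ⊤ + weigh W′ ⊤)) ∎
        where
        open import Relation.Binary.Reasoning.Setoid setoid
        W′ = (l , w) ∷ W
        UD : Fin k → Subset n
        UD i = U θ ∩ D i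
        a = count D l
        b = count (A θ) l
        d = count UD l
        u = indicator (lookup (U θ) l)
        z⊤ : weigh W′ ⊤ ≈ w + weigh W ⊤
        z⊤ = weigh-∈ W ∈⊤

    -- The bound on the cost at a fixed threshold.

    module _ {f : Subset n → Carrier} (f≥0 : Nonnegative f) (sub : Submodular f) where
      open import Data.List.Extrema (DecTotalOrder.totalOrder ≤-decTotalOrder) using (max; max≤v⁺; xs≤max)

      -- For `θ` at least 0, `U θ` is the sublevel set of this key at `θ`, which is what makes the
      -- greedy weights tight on it. The default `0#` of the maximum is harmless for such `θ`.
      largest : Fin n → Carrier
      largest j = max 0# (tabulate (λ i → x i j))

      U-lower : ∀ {θ} → 0# ≤ θ → ∀ {j l} → largest j ≤ largest l → l ∈ U θ → j ∈ U θ
      U-lower {θ} 0≤θ {j} {l} j≤l l∈U = ∈-U⁺ x (λ i j∈A → ≤⇒≯ (begin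
        x i j      ≤⟨ All.tabulate⁻ {f = λ i → x i j} (xs≤max 0# (tabulate (λ i → x i j))) i ⟩
        largest j  ≤⟨ j≤l ⟩
        largest l  ≤⟨ max≤v⁺ 0≤θ (All.tabulate⁺ (λ i → ≮⇒≥ (∈-U⁻ x l∈U i ∘ ∈-above⁺))) ⟩
        θ          ∎) (∈-above⁻ j∈A))
        where open ≤-Reasoning

      open Support f sub largest

      F Z S : Carrier → Carrier
      F θ = sum (λ i → f (A θ i))
      Z θ = total weights (A θ)
      S θ = sum (λ i′ → sum (λ i → f (rounded θ i′ i)))

      z⊤ : Carrier
      z⊤ = weigh weights ⊤

      -- For each `i′` the rounded cost is `F θ` with the term `f (A θ i′)` exchanged for
      -- `f (A θ i′ ∪ U θ)`. Adding `F θ` on the left avoids subtracting the old terms.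
      S-formula : ∀ θ → S θ + F θ ≈ κ * F θ + sum (λ i → f (A θ i ∪ U θ))
      S-formula θ = begin
        S θ + F θ                                                    ≈⟨ ∑-distrib-+ (λ i′ → sum (λ i → f (rounded θ i′ i))) (λ i → f (A θ i)) ⟨
        sum (λ i′ → sum (λ i → f (rounded θ i′ i)) + f (A θ i′))     ≈⟨ sum-cong-≋ (λ i′ → sum-update i′ (λ i i≢i′ → reflexive (≡.cong f (rounded-other x θ i≢i′)))) ⟩
        sum (λ i′ → F θ + f (rounded θ i′ i′))                       ≈⟨ sum-cong-≋ (λ i′ → +-congˡ {F θ} (reflexive (≡.cong f (rounded-same x θ i′)))) ⟩
        sum (λ i′ → F θ + f (A θ i′ ∪ U θ))                          ≈⟨ ∑-distrib-+ (λ _ → F θ) (λ i → f (A θ i ∪ U θ)) ⟩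
        sum {k} (λ _ → F θ) + sum (λ i → f (A θ i ∪ U θ))            ≈⟨ +-congʳ (sum-const k (F θ)) ⟩
        κ * F θ + sum (λ i → f (A θ i ∪ U θ))                        ∎
        where open import Relation.Binary.Reasoning.Setoid setoid

      module _ {θ} (½<θ : ½ < θ) where
        private
          δ e zU G d : Carrier
          δ  = 1# - θ
          e  = f ⊥
          zU = weigh weights (U θ)
          G  = sum (λ i → f (A θ i ∪ U θ))
          d  = total weights (λ i → U θ ∩ A δ i)

        -- An element of `A δ i` outside `U θ` lies in some `A θ l`, and `levels-disjoint` at `δ`
        -- and `θ` forces `l` to be `i`.
        U∪D≡A∪U : ∀ i → U θ ∪ A δ i ≡ A θ i ∪ U θ
        U∪D≡A∪U i = ⊆-antisym
          (λ {j} j∈ → x∈p∪q⁺ (case x∈p∪q⁻ (U θ) _ j∈ of λ where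
             (inj₁ j∈U) → inj₂ j∈U
             (inj₂ j∈D) → case A⊎U x θ j of λ where
               (inj₂ j∈U)        → inj₂ j∈U
               (inj₁ (l , j∈Aₗ)) → inj₁ (≡.subst (λ i → j ∈ A θ i)
                 (≡.sym (levels-disjoint x 0≤x ∑x≈1 (1≤δ+θ ½<θ) j∈D j∈Aₗ)) j∈Aₗ)))
          (λ j∈ → x∈p∪q⁺ (case x∈p∪q⁻ (A θ i) _ j∈ of λ where
             (inj₁ j∈A) → inj₂ (A⊆D ½<θ i j∈A)
             (inj₂ j∈U) → inj₁ j∈U))

        -- Submodularity for `U θ` and `A δ i`: tightness replaces `f (U θ)` exactly, the minorant
        -- bounds `f (U θ ∩ A δ i)` from below, and the two copies of `f ⊥` cancel.
        uncross : ∀ i → f (A θ i ∪ U θ) + weigh weights (U θ ∩ A δ i) ≤ zU + f (A δ i)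
        uncross i = 0≤y-x⇒x≤y (begin
          0#                                        ≤⟨ x≤y⇒0≤y-x chain ⟩
          zU + e + f (A δ i) - (f (A θ i ∪ U θ) + (z + e))
            ≈⟨ solve 5 (λ u e a b z → u :+ e :+ a :- (b :+ (z :+ e)) := u :+ a :- (b :+ z)) refl zU e (f (A δ i)) (f (A θ i ∪ U θ)) z ⟩
          zU + f (A δ i) - (f (A θ i ∪ U θ) + z)    ∎)
          where
          open ≤-Reasoning
          z = weigh weights (U θ ∩ A δ i)
          chain : f (A θ i ∪ U θ) + (z + e) ≤ zU + e + f (A δ i)
          chain = begin
            f (A θ i ∪ U θ) + (z + e)               ≤⟨ +-monoʳ-≤ _ (weigh-≤ _) ⟩
            f (A θ i ∪ U θ) + f (U θ ∩ A δ i)       ≡⟨ ≡.cong (λ B → f B + f (U θ ∩ A δ i)) (U∪D≡A∪U i) ⟨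
            f (U θ ∪ A δ i) + f (U θ ∩ A δ i)       ≤⟨ sub _ _ ⟩
            f (U θ) + f (A δ i)                     ≈⟨ +-congʳ (weigh-≈ (U θ) (U-lower (inj₁ (<-trans ½-pos ½<θ)))) ⟨
            zU + e + f (A δ i)                      ∎

        sum-uncross : G + d ≤ κ * zU + F δ
        sum-uncross = begin
          G + d                                     ≈⟨ ∑-distrib-+ (λ i → f (A θ i ∪ U θ)) (λ i → weigh weights (U θ ∩ A δ i)) ⟨
          sum (λ i → f (A θ i ∪ U θ) + weigh weights (U θ ∩ A δ i))  ≤⟨ sum-mono-≤ uncross ⟩
          sum (λ i → zU + f (A δ i))                ≈⟨ ∑-distrib-+ (λ _ → zU) (λ i → f (A δ i)) ⟩
          sum {k} (λ _ → zU) + F δ                  ≈⟨ +-congʳ (sum-const k zU) ⟩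
          κ * zU + F δ                              ∎
          where open ≤-Reasoning

        Z-≤-F : Z δ + κ * e ≤ F δ
        Z-≤-F = begin
          Z δ + κ * e                               ≈⟨ +-congˡ (sum-const k e) ⟨
          Z δ + sum {k} (λ _ → e)                   ≈⟨ ∑-distrib-+ (λ i → weigh weights (A δ i)) (λ _ → e) ⟨
          sum (λ i → weigh weights (A δ i) + e)     ≤⟨ sum-mono-≤ (λ i → weigh-≤ (A δ i)) ⟩
          F δ                                       ∎
          where open ≤-Reasoning

        -- Tightness on `⊤` turns the expression into `(1# + M) * f ⊥ + f ⊤`; this is where
        -- nonnegativity of `f` enters.
        0≤κe+z⊤ : 0# ≤ κ * e + z⊤
        0≤κe+z⊤ = begin
          0#                                        ≤⟨ +-nonneg (*-nonneg (fromℕ-nonneg (suc m)) (f≥0 ⊥)) (f≥0 ⊤) ⟩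
          (1# + M) * e + f ⊤                        ≈⟨ +-congˡ (weigh-≈ ⊤ (λ _ _ → ∈⊤)) ⟨
          (1# + M) * e + (z⊤ + e)                   ≈⟨ solve 3 (λ M e z → (con (+ 1) :+ M) :* e :+ (z :+ e) := (con (+ 1) :+ (con (+ 1) :+ M)) :* e :+ z) refl M e z⊤ ⟩
          κ * e + z⊤                                ∎
          where open ≤-Reasoning

        -- The gap between the two sides is an explicit nonnegative combination: the slack of
        -- `sum-uncross`, plus `M` times the slack of `Z-≤-F`, plus `M` times `κ * e + z⊤`.
        -- Eliminating `d` by `total-identity` also removes `zU`, and `e` cancels between the last
        -- two terms.
        S-bound : S θ ≤ (1# + M) * ((F θ - Z θ) + (F δ - Z δ) + (z⊤ + z⊤))
        S-bound = 0≤y-x⇒x≤y (begin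
          0#
            ≤⟨ +-nonneg (+-nonneg (x≤y⇒0≤y-x sum-uncross) (*-nonneg (fromℕ-nonneg m) (x≤y⇒0≤y-x Z-≤-F))) (*-nonneg (fromℕ-nonneg m) 0≤κe+z⊤) ⟩
          (κ * zU + F δ - (G + d)) + M * (F δ - (Z δ + κ * e)) + M * (κ * e + z⊤)
            ≈⟨ +-congʳ (+-congʳ (+-congˡ (-‿cong (+-congˡ d-formula)))) ⟩
          (κ * zU + F δ - (G + (κ * zU + M * z⊤ + (1# + M) * (Z δ + Z θ - (z⊤ + z⊤)) - M * Z δ))) + M * (F δ - (Z δ + κ * e)) + M * (κ * e + z⊤)
            ≈⟨ solve 9 (λ M Fθ Fδ Zθ Zδ G e z u →
                 let κ = con (+ 1) :+ (con (+ 1) :+ M) in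
                 (κ :* u :+ Fδ :- (G :+ (κ :* u :+ M :* z :+ (con (+ 1) :+ M) :* (Zδ :+ Zθ :- (z :+ z)) :- M :* Zδ)))
                   :+ M :* (Fδ :- (Zδ :+ κ :* e)) :+ M :* (κ :* e :+ z)
                 := (con (+ 1) :+ M) :* ((Fθ :- Zθ) :+ (Fδ :- Zδ) :+ (z :+ z)) :- (κ :* Fθ :+ G :- Fθ))
                 refl M (F θ) (F δ) (Z θ) (Z δ) G e z⊤ zU ⟩
          (1# + M) * ((F θ - Z θ) + (F δ - Z δ) + (z⊤ + z⊤)) - (κ * F θ + G - F θ)
            ≈⟨ +-congˡ (-‿cong (+-congʳ (S-formula θ))) ⟨
          (1# + M) * ((F θ - Z θ) + (F δ - Z δ) + (z⊤ + z⊤)) - (S θ + F θ - F θ)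
            ≈⟨ +-congˡ (-‿cong (solve 2 (λ s f → s :+ f :- f := s) refl (S θ) (F θ))) ⟩
          (1# + M) * ((F θ - Z θ) + (F δ - Z δ) + (z⊤ + z⊤)) - S θ ∎)
          where
          open ≤-Reasoning
          d-formula : d ≈ κ * zU + M * z⊤ + (1# + M) * (Z δ + Z θ - (z⊤ + z⊤)) - M * Z δ
          d-formula = trans (solve 2 (λ p d → d := p :+ d :- p) refl (M * Z δ) d)
                            (+-congʳ (total-identity ½<θ weights))

      -- Integration over the threshold.

      breakpoints : List Carrier
      breakpoints = concat (tabulate (λ i → tabulate (x i)))

      -- Indicators, values of `f` on a level set and `H` all depend on θ only through the family
      -- `A θ`, so one argument shows that `breakpoints` resolves each of them.
      module _ (Φ : (Fin k → Subset n) → Carrier) (Φ-cong : ∀ {B C} → (∀ i → B i ≡ C i) → Φ B ≈ Φ C) where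

        levels-cong : ∀ {θ θ′} → θ ≈ θ′ → Φ (A θ) ≈ Φ (A θ′)
        levels-cong θ≈θ′ = Φ-cong (λ i → above-≈ (x i) θ≈θ′)

        levels-pc : ∀ {a b} → PiecewiseConstant (λ θ → Φ (A θ)) breakpoints a b
        levels-pc _ _ same = Φ-cong (λ i → above-cong (x i) (All.tabulate⁻ (All.tabulate⁻ {f = λ i → tabulate (x i)} (All.concat⁻ same) i)))

      -- The thresholds in (0, 1) below `x i j` have length `x i j`. After reduction to the single
      -- break `y`, the cases `y ≈ 0#` and `y ≈ 1#` stand apart because a break at an endpoint makes
      -- no cut.
      ∫-indicator : ∀ i j → integrate (λ θ → indicator (lookup (A θ i) j)) breakpoints 0# 1# ≈ x i j
      ∫-indicator i j = trans
        (integrate-breaks (levels-cong Φ Φ-cong) breakpoints (y ∷ []) (levels-pc Φ Φ-cong) pc)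
        single
        where
        open import Relation.Binary.Reasoning.Setoid setoid
        y = x i j
        Φ : (Fin k → Subset n) → Carrier
        Φ B = indicator (lookup (B i) j)
        Φ-cong : ∀ {B C} → (∀ i → B i ≡ C i) → Φ B ≈ Φ C
        Φ-cong eq = reflexive (≡.cong (λ S → indicator (lookup S j)) (eq i))
        g : Carrier → Carrier
        g θ = Φ (A θ)
        below : ∀ {θ} → θ < y → g θ ≈ 1#
        below θ<y = indicator-∈ {l = j} (∈-above⁺ {y = x i} θ<y)
        beyond : ∀ {θ} → y < θ → g θ ≈ 0#
        beyond y<θ = indicator-∉ {l = j} (asym y<θ ∘ ∈-above⁻ {y = x i})
        pc : PiecewiseConstant g (y ∷ []) 0# 1#
        pc _ _ (inj₁ (l , l′) ∷ []) = trans (beyond l) (sym (beyond l′))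
        pc _ _ (inj₂ (l , l′) ∷ []) = trans (below l) (sym (below l′))
        single : integrate g (y ∷ []) 0# 1# ≈ y
        single = case 0≤x i j , x≤1 x 0≤x ∑x≈1 i j of λ where
          (inj₁ 0<y , inj₁ y<1) → begin
            integrate g (y ∷ []) 0# 1#                                          ≡⟨ integrate-cut g [] 0<y y<1 ⟩
            (y - 0#) * g ((0# + y) * ½) + (1# - y) * g ((y + 1#) * ½)           ≈⟨ +-cong (*-congˡ (below (mid<b 0<y))) (*-congˡ (beyond (a<mid y<1))) ⟩
            (y - 0#) * 1# + (1# - y) * 0#                                       ≈⟨ solve 1 (λ y → (y :- con (+ 0)) :* con (+ 1) :+ (con (+ 1) :- y) :* con (+ 0) := y) refl y ⟩
            y                                                                   ∎
          (inj₂ 0≈y , _) → begin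
            integrate g (y ∷ []) 0# 1#                                          ≡⟨ integrate-skip g [] (irrefl 0≈y ∘ proj₁) ⟩
            (1# - 0#) * g ((0# + 1#) * ½)                                       ≈⟨ *-congˡ (beyond (<-respˡ-≈ 0≈y (a<mid 0<1))) ⟩
            (1# - 0#) * 0#                                                      ≈⟨ zeroʳ _ ⟩
            0#                                                                  ≈⟨ 0≈y ⟩
            y                                                                   ∎
          (_ , inj₂ y≈1) → begin
            integrate g (y ∷ []) 0# 1#                                          ≡⟨ integrate-skip g [] (irrefl y≈1 ∘ proj₂) ⟩
            (1# - 0#) * g ((0# + 1#) * ½)                                       ≈⟨ *-congˡ (below (<-respʳ-≈ (sym y≈1) (mid<b 0<1))) ⟩
            (1# - 0#) * 1#                                                      ≈⟨ solve 0 ((con (+ 1) :- con (+ 0)) :* con (+ 1) := con (+ 1)) refl ⟩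
            1#                                                                  ≈⟨ y≈1 ⟨
            y                                                                   ∎

      ∫-total : ∀ W → integrate (λ θ → total W (A θ)) breakpoints 0# 1# ≈ weigh W ⊤
      ∫-total [] = trans (integrate-ext {h = λ _ → 0#} breakpoints 0# 1# (λ _ → trans (sum-const k 0#) (zeroʳ κ)))
        (trans (integrate-const 0# breakpoints 0# 1#) (zeroʳ _))
      ∫-total ((l , w) ∷ W) = begin
        ∫ (λ θ → total ((l , w) ∷ W) (A θ))                              ≈⟨ integrate-ext breakpoints 0# 1# (λ θ → trans (total-∷ l w W (A θ)) (+-congʳ (*-comm _ w))) ⟩
        ∫ (λ θ → w * count (A θ) l + total W (A θ))                      ≈⟨ integrate-+ (λ θ → w * count (A θ) l) (λ θ → total W (A θ)) breakpoints 0# 1# ⟩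
        ∫ (λ θ → w * count (A θ) l) + ∫ (λ θ → total W (A θ))            ≈⟨ +-cong (integrate-* w (λ θ → count (A θ) l) breakpoints 0# 1#) (∫-total W) ⟩
        w * ∫ (λ θ → count (A θ) l) + weigh W ⊤                          ≈⟨ +-congʳ (*-congˡ (integrate-sum (λ i θ → indicator (lookup (A θ i) l)) breakpoints 0# 1#)) ⟩
        w * sum (λ i → ∫ (λ θ → indicator (lookup (A θ i) l))) + weigh W ⊤  ≈⟨ +-congʳ (*-congˡ (trans (sum-cong-≋ (λ i → ∫-indicator i l)) (∑x≈1 l))) ⟩
        w * 1# + weigh W ⊤                                               ≈⟨ +-congʳ (*-identityʳ w) ⟩
        w + weigh W ⊤                                                    ≈⟨ weigh-∈ W ∈⊤ ⟨
        weigh ((l , w) ∷ W) ⊤                                            ∎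
        where
        open import Relation.Binary.Reasoning.Setoid setoid
        ∫ : (Carrier → Carrier) → Carrier
        ∫ g = integrate g breakpoints 0# 1#

      R : Carrier
      R = relaxationValue f x

      -- `lovász f (x i)` cuts only at the coordinates of `x i`, the left side at those of all rows;
      -- `integrate-breaks` reconciles them. The divisor in `lovász` is the length `1# - 0#`.
      ∫F≈R : integrate F breakpoints 0# 1# ≈ R
      ∫F≈R = trans (integrate-sum (λ i θ → f (A θ i)) breakpoints 0# 1#) (sum-cong-≋ (λ i → begin
        integrate (λ θ → f (A θ i)) breakpoints 0# 1#
          ≈⟨ integrate-breaks (levels-cong (λ B → f (B i)) (Φ-cong i)) breakpoints (tabulate (x i)) (levels-pc (λ B → f (B i)) (Φ-cong i))
               (λ _ _ → StepFunction.constant (lovászStep f (x i))) ⟩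
        integrate (λ θ → f (A θ i)) (tabulate (x i)) 0# 1#                 ≈⟨ *-identityʳ _ ⟨
        integrate (λ θ → f (A θ i)) (tabulate (x i)) 0# 1# * 1#            ≈⟨ *-congˡ (⁻¹-unique 0<1-0 (solve 0 ((con (+ 1) :- con (+ 0)) :* con (+ 1) := con (+ 1)) refl)) ⟨
        lovász f (x i)                                                     ∎))
        where
        open import Relation.Binary.Reasoning.Setoid setoid
        Φ-cong : ∀ i {B C : Fin k → Subset n} → (∀ i → B i ≡ C i) → f (B i) ≈ f (C i)
        Φ-cong i eq = reflexive (≡.cong f (eq i))
        0<1-0 : 0# < 1# - 0#
        0<1-0 = x<y⇒0<y-x 0<1

      H : Carrier → Carrier
      H θ = F θ - Z θ

      H-cong-levels : ∀ {B C : Fin k → Subset n} → (∀ i → B i ≡ C i) →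
                      sum (λ i → f (B i)) - total weights B ≈ sum (λ i → f (C i)) - total weights C
      H-cong-levels eq = +-cong (sum-cong-≋ (λ i → reflexive (≡.cong f (eq i))))
                                (-‿cong (sum-cong-≋ (λ i → reflexive (≡.cong (weigh weights) (eq i)))))

      H-cong : ∀ {θ θ′} → θ ≈ θ′ → H θ ≈ H θ′
      H-cong = levels-cong (λ B → sum (λ i → f (B i)) - total weights B) H-cong-levels

      H-pc : ∀ {a b} → PiecewiseConstant H breakpoints a b
      H-pc = levels-pc (λ B → sum (λ i → f (B i)) - total weights B) H-cong-levels

      ∫H≈R-z⊤ : integrate H breakpoints 0# 1# ≈ R - z⊤
      ∫H≈R-z⊤ = begin
        integrate H breakpoints 0# 1#                                       ≈⟨ integrate-ext breakpoints 0# 1# (λ θ → +-congˡ (sym (-1*x≈-x (Z θ)))) ⟩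
        integrate (λ θ → F θ + - 1# * Z θ) breakpoints 0# 1#                ≈⟨ integrate-+ F (λ θ → - 1# * Z θ) breakpoints 0# 1# ⟩
        integrate F breakpoints 0# 1# + integrate (λ θ → - 1# * Z θ) breakpoints 0# 1#
          ≈⟨ +-cong ∫F≈R (trans (integrate-* (- 1#) Z breakpoints 0# 1#) (trans (-1*x≈-x _) (-‿cong (∫-total weights)))) ⟩
        R - z⊤                                                              ∎
        where
        open import Relation.Binary.Reasoning.Setoid setoid
        open import Algebra.Properties.Ring ring using (-1*x≈-x)

      reflected : List Carrier
      reflected = map (λ p → 1# - p) breakpoints

      -- The reflected function is resolved by `reflected` alone, so `breakpoints` can be discarded
      -- before changing variables. The endpoints agree with `1# - ½` and `1# - 0#` only up to
      -- `_≈_`.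
      ∫-reflected : integrate (λ θ → H (1# - θ)) (breakpoints ++ reflected) ½ 1# ≈ integrate H breakpoints 0# ½
      ∫-reflected = begin
        integrate H′ (breakpoints ++ reflected) ½ 1#      ≈⟨ integrate-++ʳ H′-cong breakpoints reflected
                                                               (pc-sub (inj₂ 1-½≈½) (inj₂ (sym 1-0≈1)) (pc-reflect H-cong H-pc)) ⟩
        integrate H′ reflected ½ 1#                       ≈⟨ integrate-cong H′-cong (pointwise-refl reflected) (sym 1-½≈½) (sym 1-0≈1) ⟩
        integrate H′ reflected (1# - ½) (1# - 0#)         ≈⟨ integrate-reflect H-cong breakpoints 0# ½ ⟩
        integrate H breakpoints 0# ½                      ∎
        where
        open import Relation.Binary.Reasoning.Setoid setoid
        H′ : Carrier → Carrier
        H′ θ = H (1# - θ)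
        H′-cong : ∀ {θ θ′} → θ ≈ θ′ → H′ θ ≈ H′ θ′
        H′-cong θ≈θ′ = H-cong (+-congˡ (-‿cong θ≈θ′))
        1-0≈1 : 1# - 0# ≈ 1#
        1-0≈1 = solve 0 (con (+ 1) :- con (+ 0) := con (+ 1)) refl

      cost : Carrier → Carrier
      cost = StepFunction.fun (costStep f)

      -- The integrals of `H` over (½, 1) and of its reflection join to the integral over (0, 1),
      -- namely `R - z⊤`, and the constant `z⊤ + z⊤` over an interval of length `½` gives back
      -- exactly the missing `z⊤`.
      ∫cost-bound : integrate cost breakpoints ½ 1# ≤ κ ⁻¹ * (1# + M) * R
      ∫cost-bound = begin
        integrate cost breakpoints ½ 1#               ≈⟨ integrate-++ˡ cost-cong breakpoints reflected (λ _ _ → StepFunction.constant (costStep f)) ⟨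
        integrate cost B ½ 1#                         ≤⟨ integrate-mono B ½<1 (λ {θ} ½<θ _ → cost≤ ½<θ) ⟩
        integrate (λ θ → ρ * (H θ + H (1# - θ) + (z⊤ + z⊤))) B ½ 1#         ≈⟨ integrate-* ρ (λ θ → H θ + H (1# - θ) + (z⊤ + z⊤)) B ½ 1# ⟩
        ρ * integrate (λ θ → H θ + H (1# - θ) + (z⊤ + z⊤)) B ½ 1#           ≈⟨ *-congˡ (trans (integrate-+ (λ θ → H θ + H (1# - θ)) (λ _ → z⊤ + z⊤) B ½ 1#) (+-congʳ (integrate-+ H (λ θ → H (1# - θ)) B ½ 1#))) ⟩
        ρ * (integrate H B ½ 1# + integrate (λ θ → H (1# - θ)) B ½ 1# + integrate (λ _ → z⊤ + z⊤) B ½ 1#)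
          ≈⟨ *-congˡ (+-cong (+-cong (integrate-++ˡ H-cong breakpoints reflected H-pc) ∫-reflected) (trans (integrate-const (z⊤ + z⊤) B ½ 1#) (*-congʳ 1-½≈½))) ⟩
        ρ * (integrate H breakpoints ½ 1# + integrate H breakpoints 0# ½ + ½ * (z⊤ + z⊤))
          ≈⟨ *-congˡ (+-congʳ (trans (+-comm _ _) (sym (integrate-split H-cong breakpoints ½-pos ½<1 H-pc)))) ⟩
        ρ * (integrate H breakpoints 0# 1# + ½ * (z⊤ + z⊤))
          ≈⟨ *-congˡ (+-cong ∫H≈R-z⊤ (trans (solve 2 (λ h z → h :* (z :+ z) := (h :+ h) :* z) refl ½ z⊤) (trans (*-congʳ ½+½≈1) (*-identityˡ z⊤)))) ⟩
        ρ * (R - z⊤ + z⊤)                             ≈⟨ *-congˡ (solve 2 (λ r z → r :- z :+ z := r) refl R z⊤) ⟩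
        ρ * R                                         ∎
        where
        open ≤-Reasoning
        -- Monotonicity and additivity compare sums over one list, so the cuts must serve both `H θ`
        -- and `H (1# - θ)`.
        B = breakpoints ++ reflected
        ρ = κ ⁻¹ * (1# + M)
        cost-cong : ∀ {θ θ′} → θ ≈ θ′ → cost θ ≈ cost θ′
        cost-cong θ≈θ′ = *-congʳ (sum-cong-≋ (λ i′ → sum-cong-≋ (λ i →
          reflexive (≡.cong f (rounded-cong (λ l → above-≈ (x l) θ≈θ′) i′ i)))))
        cost≤ : ∀ {θ} → ½ < θ → cost θ ≤ ρ * (H θ + H (1# - θ) + (z⊤ + z⊤))
        cost≤ {θ} ½<θ = begin
          S θ * κ ⁻¹                                                ≈⟨ *-comm _ _ ⟩
          κ ⁻¹ * S θ                                                ≤⟨ *-monoˡ-≤ (inj₁ (⁻¹-pos (fromℕ-pos (suc m)))) (S-bound ½<θ) ⟩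
          κ ⁻¹ * ((1# + M) * (H θ + H (1# - θ) + (z⊤ + z⊤)))        ≈⟨ *-assoc _ _ _ ⟨
          ρ * (H θ + H (1# - θ) + (z⊤ + z⊤))                        ∎

      -- Dividing by the length `1# - ½` contributes the factor 2, and `1# + M` is `κ` minus 1, so
      -- the factor `κ ⁻¹ * (1# + M)` doubles to `fromℕ 2 - fromℕ 2 ÷ κ`.
      expectedCost-bound : expectedCost f ≤ (fromℕ 2 - fromℕ 2 ÷ κ) * R
      expectedCost-bound = begin
        integrate cost breakpoints ½ 1# ÷ (1# - ½)    ≈⟨ *-congˡ (⁻¹-unique 0<1-½ half) ⟩
        integrate cost breakpoints ½ 1# * fromℕ 2     ≈⟨ *-comm _ _ ⟩
        fromℕ 2 * integrate cost breakpoints ½ 1#     ≤⟨ *-monoˡ-≤ (fromℕ-nonneg 2) ∫cost-bound ⟩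
        fromℕ 2 * (κ ⁻¹ * (1# + M) * R)
          ≈⟨ solve 4 (λ t k M R → t :* (k :* (con (+ 1) :+ M) :* R) := (t :* ((con (+ 1) :+ (con (+ 1) :+ M)) :* k) :- t :* k) :* R) refl (fromℕ 2) (κ ⁻¹) M R ⟩
        (fromℕ 2 * (κ * κ ⁻¹) - fromℕ 2 * κ ⁻¹) * R   ≈⟨ *-congʳ (+-congʳ (trans (*-congˡ (⁻¹-inverse (fromℕ-pos (suc m)))) (*-identityʳ _))) ⟩
        (fromℕ 2 - fromℕ 2 ÷ κ) * R                   ∎
        where
        open ≤-Reasoning
        0<1-½ : 0# < 1# - ½
        0<1-½ = x<y⇒0<y-x ½<1
        half : (1# - ½) * fromℕ 2 ≈ 1#
        half = trans (*-congʳ 1-½≈½) (trans (solve 1 (λ h → h :* (con (+ 1) :+ (con (+ 1) :+ con (+ 0))) := h :+ h) refl ½) ½+½≈1)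

theorem2 : ∀ {c ℓ₁ ℓ₂} (K : OrderedField c ℓ₁ ℓ₂) →
    let open OrderedField K
        open MultiwayPartition K
    in
    (n k : ℕ) → 2 ℕ.≤ k →
    (f : Subset n → Carrier) → Nonnegative f → Submodular f →
    (t : Fin k → Fin n) → Injective _≡_ _≡_ t →
    (x : Fin k → Fin n → Carrier) → Feasible t x →
    let open Rounding x in
    (∀ θ → ½ < θ → θ ≤ 1# → ∀ i′ →
       IsPartition (rounded θ i′) × (θ < 1# → ∀ i → t i ∈ rounded θ i′ i))
    ×
    (expectedCost f ≤ (fromℕ 2 - fromℕ 2 ÷ fromℕ k) * relaxationValue f x)
theorem2 K n (suc (suc m)) (ℕ.s≤s (ℕ.s≤s ℕ.z≤n)) f f≥0 sub t _ x feasible =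
  (λ θ ½<θ _ i′ → rounded-isPartition x nonneg assigned ½<θ i′ ,
     -- Strictness matters: at θ = 1 every level set is empty and all terminals fall into the part
     -- of `i′`.
     λ θ<1 i → A⊆rounded x θ i′ i (∈-above⁺ (<-respʳ-≈ (sym (terminal i)) θ<1))) ,
  expectedCost-bound x nonneg assigned f≥0 sub
  where
  open OrderedField K using (sym)
  open MultiwayPartition K
  open OrderedFieldProperties K
  open RoundingProperties K
  open Analysis
  open Feasible feasible
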